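{- Let $T=([n],E)$ be a tree with distance matrix $D=(d(i,j))_{1\le i,j\le n}$, and let $S\subseteq[n]$ be a subset of cardinality $m\ge 2$. Let $D[S]=(d(i,j))_{i,j\in S}$ be the principal submatrix of $D$ indexed by $S$. Then $$\det D[S]=(-1)^{m-1}2^{m-2}\left((m-1)\,\#\mathcal F_1(T;S)-\sum_{F\in\mathcal F_2(T;S)}\big(\delta(F_*)-1\big)\big(\delta(F_*)-4\big)\right).$$
   Context: $[n]=\{1,\dots,n\}$; $d(i,j)$ is the number of edges of the unique path from $i$ to $j$ in $T$. A spanning forest of $T$ is an (acyclic) subgraph of $T$ containing every vertex of $T$; isolated vertices count as connected components. $\mathcal F_1(T;S)$ is the set of $S$-rooted spanning forests of $T$: spanning forests with exactly $m=\#S$ connected components, each containing exactly one vertex of $S$. $\mathcal F_2(T;S)$ is the set of $(S,*)$-rooted spanning forests of $T$: spanning forests $F$ with exactly $m+1$ connected components, exactly one of which contains no vertex of $S$ (so each other component contains exactly one vertex of $S$). The component without vertices of $S$ is denoted $F_*$ and called the floating component of $F$. The boundary degree $\delta(F_*)$ is the number of vertices of $T$ that do not belong to $F_*$ but are adjacent in $T$ to some vertex of $F_*$. -}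

module Defs where

import Data.Bool.Properties as Bool
open import Data.Fin using (Fin; zero; suc; toℕ; punchIn; _<_)
open import Data.Fin.Properties using (_≟_; any?)
open import Data.Fin.Subset using (Subset; inside; outside; _∈_; _∉_; _∩_; ∣_∣; ⊤; ⋃)
open import Data.Fin.Subset.Properties using (_∈?_; nonempty?; ⊆-max)
open import Data.Integer using (ℤ; +_; 0ℤ; 1ℤ; -1ℤ; _+_; _*_; _^_)
open import Data.Integer.Properties using (+-0-commutativeMonoid)
open import Data.List using (List; []; _∷_; [_]; _++_; map; filter; foldr; length; allFin; deduplicate; cartesianProduct)
open import Data.List.Membership.Propositional using () renaming (_∈_ to _∈ₗ_)
open import Data.List.Membership.Propositional.Properties using (∈-filter⁺; ∈-filter⁻; ∈-allFin; ∈-cartesianProduct⁺)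
open import Data.List.Relation.Unary.All using (All; all?)
open import Data.List.Relation.Unary.Any using (here; there)
open import Data.List.Relation.Unary.Unique.Propositional using (Unique)
open import Data.Nat as ℕ using (ℕ; zero; suc; _≤_)
open import Data.Product using (Σ; ∃-syntax; _×_; _,_; proj₁; proj₂)
open import Data.Product.Properties using (≡-dec)
open import Data.Sum using (_⊎_; inj₁; inj₂; [_,_]′)
open import Data.Vec using (Vec; []; _∷_; lookup; tabulate)
import Data.Vec as Vec
import Data.Vec.Properties as Vec
open import Function.Definitions using (Injective)
open import Relation.Binary using (Rel; Decidable)
open import Relation.Binary.Construct.Closure.ReflexiveTransitive using (Star; ε; _◅_; _◅◅_; gmap)
open import Relation.Binary.PropositionalEquality using (_≡_; refl; cong; subst)
open import Relation.Nullary using (¬_; does; ¬?; map′; _×-dec_; _⊎-dec_)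
import Relation.Unary as U
open import Algebra.Properties.CommutativeMonoid.Sum +-0-commutativeMonoid using (sum)

-- Reflexive-transitive closure of a decidable relation on a finite set,
-- by recursion on the list of related pairs.

module _ {n : ℕ} where

  private
    Listed : List (Fin n × Fin n) → Rel (Fin n) _
    Listed es i j = (i , j) ∈ₗ es

    split : ∀ {a b es i j} → Star (Listed ((a , b) ∷ es)) i j →
            Star (Listed es) i j ⊎ (Star (Listed es) i a × Star (Listed es) b j)
    split ε = inj₁ ε
    split (here refl ◅ w) = inj₂ (ε , [ (λ p → p) , proj₂ ]′ (split w))
    split (there x ◅ w) with split w
    ... | inj₁ p       = inj₁ (x ◅ p)
    ... | inj₂ (p , q) = inj₂ (x ◅ p , q)

    unsplit : ∀ {a b es i j} →
              Star (Listed es) i j ⊎ (Star (Listed es) i a × Star (Listed es) b j) →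
              Star (Listed ((a , b) ∷ es)) i j
    unsplit (inj₁ p)       = gmap (λ i → i) there p
    unsplit (inj₂ (p , q)) = gmap (λ i → i) there p ◅◅ here refl ◅ gmap (λ i → i) there q

    listed? : ∀ es → Decidable (Star (Listed es))
    listed? [] i j = map′ (λ { refl → ε }) (λ { ε → refl }) (i ≟ j)
    listed? ((a , b) ∷ es) i j =
      map′ unsplit split (listed? es i j ⊎-dec (listed? es i a ×-dec listed? es b j))

  star? : ∀ {ℓ} {R : Rel (Fin n) ℓ} → Decidable R → Decidable (Star R)
  star? {R = R} R? i j = map′ (gmap (λ k → k) from) (gmap (λ k → k) to) (listed? pairs i j)
    where
    R²? : U.Decidable (λ (e : Fin n × Fin n) → R (proj₁ e) (proj₂ e))
    R²? e = R? (proj₁ e) (proj₂ e)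

    pairs : List (Fin n × Fin n)
    pairs = filter R²? (cartesianProduct (allFin n) (allFin n))

    from : ∀ {k l} → Listed pairs k l → R k l
    from x = proj₂ (∈-filter⁻ R²? {xs = cartesianProduct (allFin n) (allFin n)} x)

    to : ∀ {k l} → R k l → Listed pairs k l
    to r = ∈-filter⁺ R²? (∈-cartesianProduct⁺ (∈-allFin _) (∈-allFin _)) r

-- A finite simple graph on Fin n.  The edge {i , j} is stored once, as the
-- pair (i , j) with i < j, which excludes loops and parallel edges.

record Graph (n : ℕ) : Set where
  field
    #E        : ℕ
    ends      : Fin #E → Fin n × Fin n
    ordered   : ∀ e → proj₁ (ends e) < proj₂ (ends e)
    injective : Injective _≡_ _≡_ ends

module _ {n : ℕ} (G : Graph n) where

  open Graph G

  -- A spanning subgraph has all the vertices of G, so it is determined by its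
  -- set of edges; G itself corresponds to ⊤.

  Spanning : Set
  Spanning = Subset #E

  Adj : Spanning → Rel (Fin n) _
  Adj F i j = ∃[ e ] e ∈ F × (ends e ≡ (i , j) ⊎ ends e ≡ (j , i))

  adj? : ∀ F → Decidable (Adj F)
  adj? F i j = any? λ e → (e ∈? F) ×-dec ((ends e ≟² (i , j)) ⊎-dec (ends e ≟² (j , i)))
    where _≟²_ = ≡-dec _≟_ _≟_

  Walk : Spanning → Rel (Fin n) _
  Walk F = Star (Adj F)

  edgeCount : ∀ {F i j} → Walk F i j → ℕ
  edgeCount ε       = 0
  edgeCount (_ ◅ w) = suc (edgeCount w)

  vertices : ∀ {F i j} → Walk F i j → List (Fin n)
  vertices {i = i} ε       = [ i ]
  vertices {i = i} (_ ◅ w) = i ∷ vertices w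

  Path : Spanning → Rel (Fin n) _
  Path F i j = Σ (Walk F i j) λ w → Unique (vertices w)

  -- An edge ij together with a path from j back to i of at least two edges.

  Cycle : Spanning → Set
  Cycle F = ∃[ i ] ∃[ j ] Adj F i j × Σ (Path F j i) λ p → 2 ≤ edgeCount (proj₁ p)

  Acyclic : Spanning → Set
  Acyclic F = ¬ Cycle F

  record IsTree : Set where
    field
      path    : ∀ i j → Path ⊤ i j
      acyclic : Acyclic ⊤

  connected? : ∀ F → Decidable (Walk F)
  connected? F = star? (adj? F)

  component : Spanning → Fin n → Subset n
  component F i = tabulate λ j → does (connected? F i j)

  components : Spanning → List (Subset n)
  components F = deduplicate (Vec.≡-dec Bool._≟_) (map (component F) (allFin n))

  Boundary : Subset n → Fin n → Set
  Boundary C v = v ∉ C × ∃[ u ] u ∈ C × Adj ⊤ v u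

  boundary? : ∀ C → U.Decidable (Boundary C)
  boundary? C v = ¬? (v ∈? C) ×-dec any? λ u → (u ∈? C) ×-dec adj? ⊤ v u

  boundaryDegree : Subset n → ℕ
  boundaryDegree C = length (filter (boundary? C) (allFin n))

subsets : ∀ k → List (Subset k)
subsets zero    = [ [] ]
subsets (suc k) = map (outside ∷_) (subsets k) ++ map (inside ∷_) (subsets k)

-- Every spanning subgraph of a tree is acyclic, so Rooted and *-Rooted below
-- need not ask for acyclicity.

module _ {n : ℕ} (G : Graph n) where

  private
    embed : ∀ {F i j} → Adj G F i j → Adj G ⊤ i j
    embed {F} (e , e∈F , eq) = e , ⊆-max F e∈F , eq

    up : ∀ {F i j} → Walk G F i j → Walk G ⊤ i j
    up = gmap (λ i → i) embed

    up-vertices : ∀ {F i j} (w : Walk G F i j) → vertices G w ≡ vertices G (up w)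
    up-vertices ε               = refl
    up-vertices {i = i} (_ ◅ w) = cong (i ∷_) (up-vertices w)

    up-edgeCount : ∀ {F i j} (w : Walk G F i j) → edgeCount G w ≡ edgeCount G (up w)
    up-edgeCount ε       = refl
    up-edgeCount (_ ◅ w) = cong suc (up-edgeCount w)

  spanning-acyclic : IsTree G → ∀ F → Acyclic G F
  spanning-acyclic tree F (i , j , a , (w , u) , l) =
    IsTree.acyclic tree
      (i , j , embed a , (up w , subst Unique (up-vertices w) u) , subst (2 ≤_) (up-edgeCount w) l)

module _ {n : ℕ} (T : Graph n) (S : Subset n) where

  open Graph T using (#E)

  Rooted : Spanning T → Set
  Rooted F = length (components T F) ≡ ∣ S ∣ ×
             All (λ C → ∣ C ∩ S ∣ ≡ 1) (components T F)

  rooted? : U.Decidable Rooted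
  rooted? F = (length (components T F) ℕ.≟ ∣ S ∣) ×-dec
              all? (λ C → ∣ C ∩ S ∣ ℕ.≟ 1) (components T F)

  floatingComponents : Spanning T → List (Subset n)
  floatingComponents F = filter (λ C → ¬? (nonempty? (C ∩ S))) (components T F)

  *-Rooted : Spanning T → Set
  *-Rooted F = length (components T F) ≡ suc ∣ S ∣ ×
               length (floatingComponents F) ≡ 1

  *-rooted? : U.Decidable *-Rooted
  *-rooted? F = (length (components T F) ℕ.≟ suc ∣ S ∣) ×-dec
                (length (floatingComponents F) ℕ.≟ 1)

  𝓕₁ : List (Spanning T)
  𝓕₁ = filter rooted? (subsets #E)

  𝓕₂ : List (Spanning T)
  𝓕₂ = filter *-rooted? (subsets #E)

  -- F in 𝓕₂ has exactly one floating component, so the union is that component.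

  floating : Spanning T → Subset n
  floating F = ⋃ (floatingComponents F)

Matrix : Set → ℕ → Set
Matrix A m = Fin m → Fin m → A

-- Laplace expansion along the first row.

det : ∀ {m} → Matrix ℤ m → ℤ
det {zero}  A = 1ℤ
det {suc m} A = sum λ j → -1ℤ ^ toℕ j * A zero j * det λ k l → A (suc k) (punchIn j l)

elements : ∀ {n} (S : Subset n) → Vec (Fin n) ∣ S ∣
elements []             = []
elements (inside  ∷ S) = zero ∷ Vec.map suc (elements S)
elements (outside ∷ S) = Vec.map suc (elements S)

principal : ∀ {A n} → Matrix A n → (S : Subset n) → Matrix A ∣ S ∣
principal A S k l = A (lookup (elements S) k) (lookup (elements S) l)

distance : ∀ {n} {T : Graph n} → IsTree T → Fin n → Fin n → ℕ
distance {T = T} tree i j = edgeCount T (proj₁ (IsTree.path tree i j))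

distanceMatrix : ∀ {n} {T : Graph n} → IsTree T → Matrix ℤ n
distanceMatrix tree i j = + distance tree i j

sumOver : ∀ {A : Set} → List A → (A → ℤ) → ℤ
sumOver xs f = foldr _+_ 0ℤ (map f xs)

{-# OPTIONS --safe #-}
module Submission where

-- Build the tree leaf by leaf, the new leaf v hanging at u, and border the distance
-- matrix by an index ∞ at distance 1 from every vertex.  Then row v is row u plus row ∞
-- minus twice the indicator of v, so every minor involving v reduces to minors of the
-- smaller tree.  Write [R|C] for the minor with rows R and columns C, and m = |S|.
-- Besides [S|S], the minors [∞S|∞S], [∞S|wS] and [∞xS|∞yS] close up under these
-- reductions, and up to a constant times (-2)^m they count the S-rooted forests, the
-- (S,*)-rooted forests with w floating, weighted by δ - 2, and those with both x and y
-- floating.  Cutting or keeping the edge vu gives the same recursions for the forests,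
-- because (δ - 1)(δ - 4) grows by 2(δ - 2) when δ grows by 1.

-- Moving a mark from the leaf v to its neighbour u can mark u twice, so the reductions lead out of
-- the subsets. For this reason S is a vector, with repetitions allowed, in all the recursions: a
-- repeated mark kills the minors, because two rows or two columns agree, and kills the matching
-- counts, because a component then carries two marks. The induction only has to distinguish whether
-- v occurs in S never, once or more often.
--
-- The increment 2(δ - 2) leaves one constant of the weight free. It is fixed by the forests in
-- which the new leaf floats alone: if v is unmarked, [S|S] does not change although such forests
-- appear, so the weight must vanish at δ = 1. The one-vertex tree then fixes the scale. The empty
-- determinant is 1 while the only component floats with weight (0 - 1)(0 - 4) = 4, whence a factor
-- 4 in front of [S|S]; likewise [∞|w] = 1 against 0 - 2 gives a factor 2 in front of [∞S|wS].

open import Defs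
import Data.Bool.Properties as Bool
open import Data.Bool using (Bool; true; false; if_then_else_)
open import Data.Empty using (⊥; ⊥-elim)
open import Data.Fin as Fin using (Fin; zero; suc; toℕ; punchIn)
import Data.Fin.Properties as Fin
open import Data.Fin.Subset as Subset using (Subset; ⊤; inside; outside; ∣_∣; _∩_; Nonempty) renaming (_∈_ to _∈ˢ_)
import Data.Fin.Subset.Properties as Subset
open import Data.Integer using (ℤ; +_; -[1+_]; 0ℤ; 1ℤ; -1ℤ; _+_; _*_; _-_; -_; _^_)
import Data.Integer.Properties as ℤ
open import Data.Integer.Tactic.RingSolver using (solve-∀)
open import Data.List as List using (List; []; _∷_; [_]; _++_; allFin; filter; length)
import Data.List.Properties as List
open import Data.List.Membership.Propositional using (_∈_; _∉_)
open import Data.List.Membership.Propositional.Properties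
  using (∈-allFin; ∈-map⁺; ∈-map⁻; ∈-++⁺ˡ; ∈-++⁺ʳ; ∈-deduplicate⁺; ∈-deduplicate⁻; ∈-filter⁺; ∈-filter⁻)
open import Data.List.Membership.Propositional.Properties.WithK using (unique∧set⇒bag)
open import Data.List.Relation.Binary.BagAndSetEquality using (∼bag⇒↭)
open import Data.List.Relation.Binary.Permutation.Propositional as Perm using () renaming (_↭_ to _↭ˡ_)
open import Data.List.Relation.Binary.Permutation.Propositional.Properties using (↭-length; filter-↭)
open import Data.List.Relation.Unary.All as All using (All; []; _∷_; all?)
open import Data.List.Relation.Unary.All.Properties using (¬Any⇒All¬)
open import Data.List.Relation.Unary.AllPairs using ([]; _∷_)
open import Data.List.Relation.Unary.Any as Any using (here; there)
open import Data.List.Relation.Unary.Unique.Propositional using (Unique)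
import Data.List.Relation.Unary.Unique.DecPropositional.Properties as DecUnique
import Data.List.Relation.Unary.Unique.Propositional.Properties as Unique
open import Data.Maybe using (Maybe; just; nothing)
open import Data.Nat as ℕ using (ℕ; zero; suc; _≤_; _∸_; z≤n; s≤s)
open import Data.Nat.ListAction using (sum)
import Data.Nat.Properties as ℕ
open import Data.Product using (Σ; ∃-syntax; _×_; _,_; proj₁; proj₂)
open import Data.Sum using (_⊎_; inj₁; inj₂; swap)
open import Data.Unit using (tt) renaming (⊤ to 𝟏)
open import Data.Vec as Vec using (Vec; []; _∷_; lookup; count; _[_]≔_)
import Data.Vec.Properties as Vec
open import Data.Vec.Membership.Propositional using () renaming (_∈_ to _∈ᵥ_)
open import Data.Vec.Relation.Unary.All as AllVec using ([]; _∷_) renaming (All to AllVec)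
import Data.Vec.Relation.Unary.All.Properties as AllVec
import Data.Vec.Relation.Unary.AllPairs as AllPairsVec
import Data.Vec.Relation.Unary.Any as AnyVec
open import Data.Vec.Relation.Unary.Unique.Propositional using () renaming (Unique to UniqueVec)
open import Function using (_∘_; mk⇔)
open import Relation.Binary using (DecidableEquality)
open import Relation.Binary.Construct.Closure.ReflexiveTransitive using (ε; _◅_; _◅◅_)
open import Relation.Binary.PropositionalEquality
  using (_≡_; _≢_; refl; sym; trans; cong; cong₂; subst; module ≡-Reasoning)
open import Relation.Nullary using (Dec; yes; no; does; ¬_; ¬?)
open import Relation.Nullary.Decidable using (dec-true; dec-false; does-⇔)
import Relation.Unary as U
open import Algebra.Properties.CommutativeMonoid.Sum ℤ.+-0-commutativeMonoid
  using (sum-cong-≗; ∑-distrib-+; ∑-comm) renaming (sum to ∑ᶠ)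
open import Algebra.Properties.Semiring.Sum ℤ.+-*-semiring using (*-distribˡ-sum)
open ≡-Reasoning

-- Determinants

minor : ∀ {m} → Fin (suc m) → Fin (suc m) → Matrix ℤ (suc m) → Matrix ℤ m
minor i j A k l = A (punchIn i k) (punchIn j l)

det-cong : ∀ {m} {A B : Matrix ℤ m} → (∀ i j → A i j ≡ B i j) → det A ≡ det B
det-cong {zero}  A≡B = refl
det-cong {suc m} A≡B = sum-cong-≗ λ j →
  cong₂ (λ a d → -1ℤ ^ toℕ j * a * d) (A≡B zero j) (det-cong λ k l → A≡B (suc k) (punchIn j l))

firstColumnExpansion : ∀ {m} → Matrix ℤ (suc m) → ℤ
firstColumnExpansion A = ∑ᶠ λ i → -1ℤ ^ toℕ i * A i zero * det (minor i zero A)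

-- The corner terms agree. In the others, expanding each minor along its own first column gives a
-- double sum over a column `suc j` and a row `suc i`, with row `zero` and column `zero` removed as
-- well. Up to the regrouping `exchange`, rows and columns play the same part in that sum.
det-firstColumn : ∀ {m} (A : Matrix ℤ (suc m)) → det A ≡ firstColumnExpansion A
det-firstColumn {zero}  A = refl
det-firstColumn {suc m} A = cong (_+_ (-1ℤ ^ 0 * A zero zero * det (minor zero zero A))) (begin
  ∑ᶠ (λ j → -1ℤ ^ suc (toℕ j) * A zero (suc j) * det (minor zero (suc j) A))
    ≡⟨ sum-cong-≗ (λ j → trans (cong (-1ℤ ^ suc (toℕ j) * A zero (suc j) *_)
                                     (det-firstColumn (minor zero (suc j) A)))
                               (*-distribˡ-sum (-1ℤ ^ suc (toℕ j) * A zero (suc j)) (λ i → c i * e i j))) ⟩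
  ∑ᶠ (λ j → ∑ᶠ λ i → -1ℤ ^ suc (toℕ j) * A zero (suc j) * (c i * e i j))
    ≡⟨ ∑-comm (λ j i → -1ℤ ^ suc (toℕ j) * A zero (suc j) * (c i * e i j)) ⟩
  ∑ᶠ (λ i → ∑ᶠ λ j → -1ℤ ^ suc (toℕ j) * A zero (suc j) * (c i * e i j))
    ≡⟨ sum-cong-≗ (λ i → sum-cong-≗ λ j →
         exchange (-1ℤ ^ toℕ j) (A zero (suc j)) (-1ℤ ^ toℕ i) (A (suc i) zero) (e i j)) ⟩
  ∑ᶠ (λ i → ∑ᶠ λ j → -1ℤ ^ suc (toℕ i) * A (suc i) zero * (r j * e i j))
    ≡⟨ sum-cong-≗ (λ i → *-distribˡ-sum (-1ℤ ^ suc (toℕ i) * A (suc i) zero) (λ j → r j * e i j)) ⟨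
  ∑ᶠ (λ i → -1ℤ ^ suc (toℕ i) * A (suc i) zero * det (minor (suc i) zero A)) ∎)
  where
  c r : Fin (suc m) → ℤ
  c i = -1ℤ ^ toℕ i * A (suc i) zero
  r j = -1ℤ ^ toℕ j * A zero (suc j)

  e : Fin (suc m) → Fin (suc m) → ℤ
  e i j = det λ k l → A (suc (punchIn i k)) (suc (punchIn j l))

  exchange : ∀ x a y b d → -1ℤ * x * a * (y * b * d) ≡ -1ℤ * y * b * (x * a * d)
  exchange = solve-∀

det-transpose : ∀ {m} (A : Matrix ℤ m) → det (λ i j → A j i) ≡ det A
det-transpose {zero}  A = refl
det-transpose {suc m} A = begin
  det (λ i j → A j i)     ≡⟨ sum-cong-≗ (λ j → cong (-1ℤ ^ toℕ j * A j zero *_)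
                                                    (det-transpose (minor j zero A))) ⟩
  firstColumnExpansion A  ≡⟨ det-firstColumn A ⟨
  det A                   ∎

sum-neg : ∀ {m} (f : Fin m → ℤ) → ∑ᶠ (λ i → - f i) ≡ - ∑ᶠ f
sum-neg {zero}  f = refl
sum-neg {suc m} f = trans (cong (_+_ (- f zero)) (sum-neg λ i → f (suc i))) (sym (ℤ.neg-distrib-+ (f zero) _))

-- The first two terms of the expansion trade places with opposite signs. Every later minor still
-- has the two swapped columns in front, so induction negates it.
det-swapColumns : ∀ {m} (A B : Matrix ℤ (suc (suc m))) →
  (∀ k → B k zero ≡ A k (suc zero)) → (∀ k → B k (suc zero) ≡ A k zero) →
  (∀ k l → B k (suc (suc l)) ≡ A k (suc (suc l))) → det B ≡ - det A
det-swapColumns {m} A B B₀ B₁ B₊ = begin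
  det B
    ≡⟨ cong₂ _+_ (cong₂ (λ a d → 1ℤ * a * d) (B₀ zero) (det-cong minor₀))
                 (cong₂ _+_ (cong₂ (λ a d → -1ℤ * a * d) (B₁ zero) (det-cong minor₁))
                            (trans (sum-cong-≗ rest) (sum-neg (term A)))) ⟩
  1ℤ * A zero (suc zero) * det (minor zero (suc zero) A) +
    (-1ℤ * A zero zero * det (minor zero zero A) + - ∑ᶠ (term A))
    ≡⟨ rearrange (A zero (suc zero)) (det (minor zero (suc zero) A))
                 (A zero zero) (det (minor zero zero A)) (∑ᶠ (term A)) ⟩
  - det A ∎
  where
  term : Matrix ℤ (suc (suc m)) → Fin m → ℤ
  term A j = -1ℤ ^ toℕ (suc (suc j)) * A zero (suc (suc j)) * det (minor zero (suc (suc j)) A)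

  minor₀ : ∀ k l → minor zero zero B k l ≡ minor zero (suc zero) A k l
  minor₀ k zero    = B₁ (suc k)
  minor₀ k (suc l) = B₊ (suc k) l

  minor₁ : ∀ k l → minor zero (suc zero) B k l ≡ minor zero zero A k l
  minor₁ k zero    = B₀ (suc k)
  minor₁ k (suc l) = B₊ (suc k) l

  minor₊ : ∀ {m} (A B : Matrix ℤ (suc (suc m))) →
    (∀ k → B k zero ≡ A k (suc zero)) → (∀ k → B k (suc zero) ≡ A k zero) →
    (∀ k l → B k (suc (suc l)) ≡ A k (suc (suc l))) →
    ∀ j → det (minor zero (suc (suc j)) B) ≡ - det (minor zero (suc (suc j)) A)
  minor₊ {suc m} A B B₀ B₁ B₊ j =
    det-swapColumns (minor zero (suc (suc j)) A) (minor zero (suc (suc j)) B)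
      (λ k → B₀ (suc k)) (λ k → B₁ (suc k)) (λ k l → B₊ (suc k) (punchIn j l))

  rest : ∀ j → term B j ≡ - term A j
  rest j = trans (cong₂ (λ a d → -1ℤ ^ toℕ (suc (suc j)) * a * d) (B₊ zero j) (minor₊ A B B₀ B₁ B₊ j))
                 (sym (ℤ.neg-distribʳ-* (-1ℤ ^ toℕ (suc (suc j)) * A zero (suc (suc j))) _))

  rearrange : ∀ a d a′ d′ s → 1ℤ * a * d + (-1ℤ * a′ * d′ + - s) ≡ - (1ℤ * a′ * d′ + (-1ℤ * 1ℤ * a * d + s))
  rearrange = solve-∀

det-swapRows : ∀ {m} (A B : Matrix ℤ (suc (suc m))) →
  (∀ l → B zero l ≡ A (suc zero) l) → (∀ l → B (suc zero) l ≡ A zero l) →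
  (∀ k l → B (suc (suc k)) l ≡ A (suc (suc k)) l) → det B ≡ - det A
det-swapRows A B B₀ B₁ B₊ = begin
  det B                ≡⟨ det-transpose B ⟨
  det (λ i j → B j i)  ≡⟨ det-swapColumns (λ i j → A j i) (λ i j → B j i) B₀ B₁ (λ k l → B₊ l k) ⟩
  - det (λ i j → A j i) ≡⟨ cong -_ (det-transpose A) ⟩
  - det A              ∎

-- Rearrangements of index vectors and their signs

infix 4 _↭_
-- Generated by adjacent swaps. The derivation is data because `sign` is computed from it: with
-- repeated entries the same two vectors have derivations of either sign.
data _↭_ {X : Set} : ∀ {m} → Vec X m → Vec X m → Set where
  ↭-refl  : ∀ {m} {xs : Vec X m} → xs ↭ xs
  ↭-prep  : ∀ {m} x {xs ys : Vec X m} → xs ↭ ys → x ∷ xs ↭ x ∷ ys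
  ↭-swap  : ∀ {m} x y {xs : Vec X m} → x ∷ y ∷ xs ↭ y ∷ x ∷ xs
  ↭-trans : ∀ {m} {xs ys zs : Vec X m} → xs ↭ ys → ys ↭ zs → xs ↭ zs

sign : ∀ {X m} {xs ys : Vec X m} → xs ↭ ys → ℤ
sign ↭-refl        = 1ℤ
sign (↭-prep x p)  = sign p
sign (↭-swap x y)  = -1ℤ
sign (↭-trans p q) = sign p * sign q

sign² : ∀ {X m} {xs ys : Vec X m} (p : xs ↭ ys) → sign p * sign p ≡ 1ℤ
sign² ↭-refl        = refl
sign² (↭-prep x p)  = sign² p
sign² (↭-swap x y)  = refl
sign² (↭-trans p q) = trans (interchange (sign p) (sign q)) (cong₂ _*_ (sign² p) (sign² q))
  where
  interchange : ∀ a b → a * b * (a * b) ≡ a * a * (b * b)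
  interchange = solve-∀

-- Only the row labels are permuted, while `N` is arbitrary; under `↭-prep` the induction can
-- therefore pass to a minor by changing the columns of `N`.
det-permuteRows : ∀ {X m} {xs ys : Vec X m} (p : xs ↭ ys) (N : X → Fin m → ℤ) →
  det (λ i → N (lookup xs i)) ≡ sign p * det (λ i → N (lookup ys i))
det-permuteRows ↭-refl N = sym (ℤ.*-identityˡ _)
det-permuteRows (↭-prep x {xs} {ys} p) N = begin
  det (λ i → N (lookup (x ∷ xs) i))
    ≡⟨ sum-cong-≗ (λ j → trans
         (cong (-1ℤ ^ toℕ j * N x j *_) (det-permuteRows p λ z l → N z (punchIn j l)))
         (pull (-1ℤ ^ toℕ j * N x j) (sign p) (det λ k l → N (lookup ys k) (punchIn j l)))) ⟩
  ∑ᶠ (λ j → sign p * (-1ℤ ^ toℕ j * N x j * det (λ k l → N (lookup ys k) (punchIn j l))))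
    ≡⟨ *-distribˡ-sum (sign p) (λ j → -1ℤ ^ toℕ j * N x j * det (λ k l → N (lookup ys k) (punchIn j l))) ⟨
  sign p * det (λ i → N (lookup (x ∷ ys) i)) ∎
  where
  pull : ∀ a b c → a * (b * c) ≡ b * (a * c)
  pull = solve-∀
det-permuteRows (↭-swap x y {xs}) N =
  trans (det-swapRows (λ i → N (lookup (y ∷ x ∷ xs) i)) (λ i → N (lookup (x ∷ y ∷ xs) i))
           (λ _ → refl) (λ _ → refl) (λ _ _ → refl))
        (sym (ℤ.-1*i≡-i _))
det-permuteRows (↭-trans p q) N =
  trans (det-permuteRows p N)
        (trans (cong (sign p *_) (det-permuteRows q N)) (sym (ℤ.*-assoc (sign p) (sign q) _)))

self-negative : ∀ {i} → i ≡ - i → i ≡ 0ℤ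
self-negative {+ zero}         _ = refl
self-negative {+ suc _}        ()
self-negative { -[1+ _ ]} ()

+-vanishʳ : ∀ {a b c} → a ≡ b → c ≡ 0ℤ → a + c ≡ b
+-vanishʳ {b = b} refl refl = ℤ.+-identityʳ b

-- Minors of a symmetric matrix with rows and columns named by vectors

module Bracket {X : Set} (M : X → X → ℤ) (M-sym : ∀ x y → M x y ≡ M y x) where

  infix 8 ⟦_∣_⟧

  opaque
    -- Vectors rather than subsets name the rows and columns, so that an index can be exchanged for
    -- another one, moved to the front, or repeated.
    ⟦_∣_⟧ : ∀ {m} → Vec X m → Vec X m → ℤ
    ⟦ xs ∣ ys ⟧ = det λ i j → M (lookup xs i) (lookup ys j)

    bracket-sym : ∀ {m} (xs ys : Vec X m) → ⟦ xs ∣ ys ⟧ ≡ ⟦ ys ∣ xs ⟧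
    bracket-sym xs ys = trans (sym (det-transpose λ i j → M (lookup xs i) (lookup ys j)))
                              (det-cong λ i j → M-sym (lookup xs j) (lookup ys i))

    rows-↭ : ∀ {m} {xs xs′ : Vec X m} (p : xs ↭ xs′) ys → ⟦ xs ∣ ys ⟧ ≡ sign p * ⟦ xs′ ∣ ys ⟧
    rows-↭ p ys = det-permuteRows p λ x j → M x (lookup ys j)

    columns-↭ : ∀ {m} xs {ys ys′ : Vec X m} (p : ys ↭ ys′) → ⟦ xs ∣ ys ⟧ ≡ sign p * ⟦ xs ∣ ys′ ⟧
    columns-↭ xs {ys} {ys′} p =
      trans (bracket-sym xs ys) (trans (rows-↭ p xs) (cong (sign p *_) (bracket-sym ys′ xs)))

    -- The two signs multiply to a square, which is 1. Moving an index in the same way among rows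
    -- and columns is therefore free.
    both-↭ : ∀ {m} {xs xs′ ys ys′ : Vec X m} (p : xs ↭ xs′) (q : ys ↭ ys′) → sign p ≡ sign q →
      ⟦ xs ∣ ys ⟧ ≡ ⟦ xs′ ∣ ys′ ⟧
    both-↭ {xs = xs} {xs′} {ys} {ys′} p q same = begin
      ⟦ xs ∣ ys ⟧                        ≡⟨ rows-↭ p ys ⟩
      sign p * ⟦ xs′ ∣ ys ⟧              ≡⟨ cong₂ _*_ same (columns-↭ xs′ q) ⟩
      sign q * (sign q * ⟦ xs′ ∣ ys′ ⟧)  ≡⟨ ℤ.*-assoc (sign q) (sign q) _ ⟨
      sign q * sign q * ⟦ xs′ ∣ ys′ ⟧    ≡⟨ cong (_* ⟦ xs′ ∣ ys′ ⟧) (sign² q) ⟩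
      1ℤ * ⟦ xs′ ∣ ys′ ⟧                 ≡⟨ ℤ.*-identityˡ _ ⟩
      ⟦ xs′ ∣ ys′ ⟧                      ∎

    -- Swapping the two equal rows both fixes and negates the minor, and 0 is the only integer equal
    -- to its negative.
    repeatedRow : ∀ {m x} {xs : Vec X (suc (suc m))} {zs : Vec X m} (ys : Vec X (suc (suc m))) →
      xs ↭ x ∷ x ∷ zs → ⟦ xs ∣ ys ⟧ ≡ 0ℤ
    repeatedRow {x = x} {zs = zs} ys p =
      trans (rows-↭ p ys)
            (trans (cong (sign p *_) (self-negative (trans (rows-↭ (↭-swap x x {zs}) ys) (ℤ.-1*i≡-i _))))
                   (ℤ.*-zeroʳ (sign p)))

    repeatedColumn : ∀ {m y} {ys : Vec X (suc (suc m))} {zs : Vec X m} (xs : Vec X (suc (suc m))) →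
      ys ↭ y ∷ y ∷ zs → ⟦ xs ∣ ys ⟧ ≡ 0ℤ
    repeatedColumn {ys = ys} xs p = trans (bracket-sym xs ys) (repeatedRow xs p)

    row-additive : ∀ {m} (x a b : X) (xs : Vec X m) (ys : Vec X (suc m)) →
      (∀ j → M x (lookup ys j) ≡ M a (lookup ys j) + M b (lookup ys j)) →
      ⟦ x ∷ xs ∣ ys ⟧ ≡ ⟦ a ∷ xs ∣ ys ⟧ + ⟦ b ∷ xs ∣ ys ⟧
    row-additive {m} x a b xs ys x≡a+b = begin
      ⟦ x ∷ xs ∣ ys ⟧
        ≡⟨ sum-cong-≗ (λ j → trans (cong (λ z → -1ℤ ^ toℕ j * z * D j) (x≡a+b j))
                                    (distrib (-1ℤ ^ toℕ j) (M a (lookup ys j)) (M b (lookup ys j)) (D j))) ⟩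
      ∑ᶠ (λ j → T a j + T b j)  ≡⟨ ∑-distrib-+ (T a) (T b) ⟩
      ⟦ a ∷ xs ∣ ys ⟧ + ⟦ b ∷ xs ∣ ys ⟧ ∎
      where
      D : Fin (suc m) → ℤ
      D j = det λ k l → M (lookup xs k) (lookup ys (punchIn j l))

      T : X → Fin (suc m) → ℤ
      T z j = -1ℤ ^ toℕ j * M z (lookup ys j) * D j

      distrib : ∀ s a b d → s * (a + b) * d ≡ s * a * d + s * b * d
      distrib = solve-∀

    column-additive : ∀ {m} (y a b : X) (xs : Vec X (suc m)) (ys : Vec X m) →
      (∀ i → M y (lookup xs i) ≡ M a (lookup xs i) + M b (lookup xs i)) →
      ⟦ xs ∣ y ∷ ys ⟧ ≡ ⟦ xs ∣ a ∷ ys ⟧ + ⟦ xs ∣ b ∷ ys ⟧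
    column-additive y a b xs ys y≡a+b = begin
      ⟦ xs ∣ y ∷ ys ⟧                    ≡⟨ bracket-sym xs (y ∷ ys) ⟩
      ⟦ y ∷ ys ∣ xs ⟧                    ≡⟨ row-additive y a b ys xs y≡a+b ⟩
      ⟦ a ∷ ys ∣ xs ⟧ + ⟦ b ∷ ys ∣ xs ⟧  ≡⟨ cong₂ _+_ (bracket-sym (a ∷ ys) xs) (bracket-sym (b ∷ ys) xs) ⟩
      ⟦ xs ∣ a ∷ ys ⟧ + ⟦ xs ∣ b ∷ ys ⟧  ∎

    -- The defect `c` sits in a single entry, the corner, whose cofactor is `⟦ xs ∣ ys ⟧`. This is
    -- how the zero on the diagonal at a leaf enters.
    row-additive-corner : ∀ {m} (x a b y : X) (c : ℤ) (xs ys : Vec X m) →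
      M x y ≡ M a y + M b y + c →
      (∀ j → M x (lookup ys j) ≡ M a (lookup ys j) + M b (lookup ys j)) →
      ⟦ x ∷ xs ∣ y ∷ ys ⟧ ≡ ⟦ a ∷ xs ∣ y ∷ ys ⟧ + ⟦ b ∷ xs ∣ y ∷ ys ⟧ + c * ⟦ xs ∣ ys ⟧
    row-additive-corner {m} x a b y c xs ys corner x≡a+b = begin
      ⟦ x ∷ xs ∣ y ∷ ys ⟧
        ≡⟨ cong₂ _+_ (cong (λ z → 1ℤ * z * ⟦ xs ∣ ys ⟧) corner)
             (trans (sum-cong-≗ (λ j → trans (cong (λ z → -1ℤ ^ toℕ (suc j) * z * D j) (x≡a+b j))
                       (distrib (-1ℤ ^ toℕ (suc j)) (M a (lookup ys j)) (M b (lookup ys j)) (D j))))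
                    (∑-distrib-+ (T a) (T b))) ⟩
      1ℤ * (M a y + M b y + c) * ⟦ xs ∣ ys ⟧ + (∑ᶠ (T a) + ∑ᶠ (T b))
        ≡⟨ collect (M a y) (M b y) c ⟦ xs ∣ ys ⟧ (∑ᶠ (T a)) (∑ᶠ (T b)) ⟩
      ⟦ a ∷ xs ∣ y ∷ ys ⟧ + ⟦ b ∷ xs ∣ y ∷ ys ⟧ + c * ⟦ xs ∣ ys ⟧ ∎
      where
      D : Fin m → ℤ
      D j = det λ k l → M (lookup xs k) (lookup (y ∷ ys) (punchIn (suc j) l))

      T : X → Fin m → ℤ
      T z j = -1ℤ ^ toℕ (suc j) * M z (lookup ys j) * D j

      distrib : ∀ s a b d → s * (a + b) * d ≡ s * a * d + s * b * d
      distrib = solve-∀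

      collect : ∀ a b c d s t → 1ℤ * (a + b + c) * d + (s + t) ≡ 1ℤ * a * d + s + (1ℤ * b * d + t) + c * d
      collect = solve-∀

    bracket≡det : ∀ {m} (xs ys : Vec X m) → ⟦ xs ∣ ys ⟧ ≡ det λ i j → M (lookup xs i) (lookup ys j)
    bracket≡det xs ys = refl

-- Spanning forests of a tree grown leaf by leaf

𝟙 : ∀ {P : Set} → Dec P → ℤ
𝟙 P? = if does P? then 1ℤ else 0ℤ

𝟙-yes : ∀ {P : Set} (P? : Dec P) → P → 𝟙 P? ≡ 1ℤ
𝟙-yes P? p rewrite dec-true P? p = refl

𝟙-no : ∀ {P : Set} (P? : Dec P) → ¬ P → 𝟙 P? ≡ 0ℤ
𝟙-no P? ¬p rewrite dec-false P? ¬p = refl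

𝟙-⇔ : ∀ {P Q : Set} (P? : Dec P) (Q? : Dec Q) → (P → Q) → (Q → P) → 𝟙 P? ≡ 𝟙 Q?
𝟙-⇔ (yes p) Q? f g = sym (𝟙-yes Q? (f p))
𝟙-⇔ (no ¬p) Q? f g = sym (𝟙-no Q? (¬p ∘ g))

opaque
  ∑ : ∀ {k} → (Vec Bool k → ℤ) → ℤ
  ∑ {zero}  f = f []
  ∑ {suc k} f = ∑ (λ F → f (false ∷ F)) + ∑ (λ F → f (true ∷ F))

  ∑-cong : ∀ {k} {f g : Vec Bool k → ℤ} → (∀ F → f F ≡ g F) → ∑ f ≡ ∑ g
  ∑-cong {zero}  f≡g = f≡g []
  ∑-cong {suc k} f≡g = cong₂ _+_ (∑-cong λ F → f≡g (false ∷ F)) (∑-cong λ F → f≡g (true ∷ F))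

  ∑-0 : ∀ {k} {f : Vec Bool k → ℤ} → (∀ F → f F ≡ 0ℤ) → ∑ f ≡ 0ℤ
  ∑-0 {zero}  f≡0 = f≡0 []
  ∑-0 {suc k} f≡0 = cong₂ _+_ (∑-0 λ F → f≡0 (false ∷ F)) (∑-0 λ F → f≡0 (true ∷ F))

  ∑-+ : ∀ {k} (f g : Vec Bool k → ℤ) → ∑ (λ F → f F + g F) ≡ ∑ f + ∑ g
  ∑-+ {zero}  f g = refl
  ∑-+ {suc k} f g =
    trans (cong₂ _+_ (∑-+ (f ∘ (false ∷_)) (g ∘ (false ∷_))) (∑-+ (f ∘ (true ∷_)) (g ∘ (true ∷_))))
          (interchange (∑ (f ∘ (false ∷_))) (∑ (g ∘ (false ∷_))) (∑ (f ∘ (true ∷_))) (∑ (g ∘ (true ∷_))))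
    where
    interchange : ∀ a b c d → a + b + (c + d) ≡ a + c + (b + d)
    interchange = solve-∀

  ∑-* : ∀ {k} c (f : Vec Bool k → ℤ) → ∑ (λ F → c * f F) ≡ c * ∑ f
  ∑-* {zero}  c f = refl
  ∑-* {suc k} c f = trans (cong₂ _+_ (∑-* c (f ∘ (false ∷_))) (∑-* c (f ∘ (true ∷_))))
                          (sym (ℤ.*-distribˡ-+ c _ _))

  ∑-suc : ∀ {k} (f : Vec Bool (suc k) → ℤ) → ∑ f ≡ ∑ (f ∘ (true ∷_)) + ∑ (f ∘ (false ∷_))
  ∑-suc f = ℤ.+-comm (∑ (f ∘ (false ∷_))) (∑ (f ∘ (true ∷_)))

  ∑-zero : (f : Vec Bool 0 → ℤ) → ∑ f ≡ f []
  ∑-zero f = refl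

module _ {A : Set} where

  sumOver-cong : ∀ (xs : List A) {f g : A → ℤ} → (∀ {x} → x ∈ xs → f x ≡ g x) → sumOver xs f ≡ sumOver xs g
  sumOver-cong []       f≡g = refl
  sumOver-cong (x ∷ xs) f≡g = cong₂ _+_ (f≡g (here refl)) (sumOver-cong xs (f≡g ∘ there))

  sumOver-+ : ∀ (xs : List A) (f g : A → ℤ) → sumOver xs (λ x → f x + g x) ≡ sumOver xs f + sumOver xs g
  sumOver-+ []       f g = refl
  sumOver-+ (x ∷ xs) f g = trans (cong (_+_ (f x + g x)) (sumOver-+ xs f g))
                                 (interchange (f x) (g x) (sumOver xs f) (sumOver xs g))
    where
    interchange : ∀ a b c d → a + b + (c + d) ≡ a + c + (b + d)
    interchange = solve-∀

  sumOver-0 : ∀ (xs : List A) {f : A → ℤ} → (∀ {x} → x ∈ xs → f x ≡ 0ℤ) → sumOver xs f ≡ 0ℤ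
  sumOver-0 []       f≡0 = refl
  sumOver-0 (x ∷ xs) f≡0 = cong₂ _+_ (f≡0 (here refl)) (sumOver-0 xs (f≡0 ∘ there))

  sumOver-select : ∀ (_≟_ : DecidableEquality A) {xs : List A} → Unique xs → ∀ {b} → b ∈ xs → (f : A → ℤ) →
    sumOver xs (λ a → 𝟙 (a ≟ b) * f a) ≡ f b
  sumOver-select _≟_ {x ∷ xs} (x∉xs ∷ u) {b} (here refl) f =
    trans (cong₂ _+_ (trans (cong (_* f b) (𝟙-yes (b ≟ b) refl)) (ℤ.*-identityˡ (f b)))
                     (sumOver-0 xs λ a∈ → cong (_* f _) (𝟙-no (_ ≟ b) λ eq → All.lookup x∉xs a∈ (sym eq))))
          (ℤ.+-identityʳ (f b))
  sumOver-select _≟_ {x ∷ xs} (x∉xs ∷ u) {b} (there b∈) f =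
    trans (cong₂ _+_ (cong (_* f x) (𝟙-no (x ≟ b) (All.lookup x∉xs b∈))) (sumOver-select _≟_ u b∈ f))
          (ℤ.+-identityˡ (f b))

↭-map : ∀ {X Y : Set} (f : X → Y) {m} {xs ys : Vec X m} → xs ↭ ys → Vec.map f xs ↭ Vec.map f ys
↭-map f ↭-refl        = ↭-refl
↭-map f (↭-prep x p)  = ↭-prep (f x) (↭-map f p)
↭-map f (↭-swap x y)  = ↭-swap (f x) (f y)
↭-map f (↭-trans p q) = ↭-trans (↭-map f p) (↭-map f q)

-- A leaf order of a tree: `sprout v u t` hangs the new leaf `v` at `u`. The index counts edges, so
-- that a spanning forest is a bit vector of that length.
data Tree (A : Set) : ℕ → Set where
  seed   : A → Tree A 0
  sprout : ∀ {k} → A → A → Tree A k → Tree A (suc k)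

verts : ∀ {A k} → Tree A k → List A
verts (seed r)       = [ r ]
verts (sprout v u t) = v ∷ verts t

module Forests {A : Set} (_≟_ : DecidableEquality A) where

  Valid : ∀ {k} → Tree A k → Set
  Valid (seed r)       = 𝟏
  Valid (sprout v u t) = v ∉ verts t × u ∈ verts t × Valid t

  mult : ∀ {m} → A → Vec A m → ℕ
  mult a = count (a ≟_)

  mult-≡ : ∀ {m} {a b} {ms : Vec A m} → a ≡ b → mult a (b ∷ ms) ≡ suc (mult a ms)
  mult-≡ {a = a} {b} eq rewrite dec-true (a ≟ b) eq = refl

  mult-≢ : ∀ {m} {a b} {ms : Vec A m} → a ≢ b → mult a (b ∷ ms) ≡ mult a ms
  mult-≢ {a = a} {b} neq rewrite dec-false (a ≟ b) neq = refl

  mult-prep : ∀ {m n} a b (ms : Vec A m) (ns : Vec A n) → mult a ms ≡ mult a ns → mult a (b ∷ ms) ≡ mult a (b ∷ ns)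
  mult-prep a b ms ns eq with does (a ≟ b)
  ... | true  = cong suc eq
  ... | false = eq

  mult-↭ : ∀ {m} a {ms ns : Vec A m} → ms ↭ ns → mult a ms ≡ mult a ns
  mult-↭ a ↭-refl                         = refl
  mult-↭ a (↭-prep b {ms} {ns} p)         = mult-prep a b ms ns (mult-↭ a p)
  mult-↭ a (↭-swap b c) with does (a ≟ b) | does (a ≟ c)
  ... | true  | true  = refl
  ... | true  | false = refl
  ... | false | true  = refl
  ... | false | false = refl
  mult-↭ a (↭-trans p q)                  = trans (mult-↭ a p) (mult-↭ a q)

  mult-0 : ∀ {m} {a} {ms : Vec A m} → AllVec (a ≢_) ms → mult a ms ≡ 0
  mult-0 []                           = refl
  mult-0 {ms = _ ∷ ms} (a≢x ∷ a≢ms) = trans (mult-≢ {ms = ms} a≢x) (mult-0 a≢ms)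

  -- In use, `τ` lists the components and `ms` the components of the marked vertices, so this is the
  -- condition that every component carries exactly one mark. A mark that occurs twice in the vector
  -- counts twice.
  Covers : ∀ {m} → List A → Vec A m → Set
  Covers τ ms = All (λ a → mult a ms ≡ 1) τ

  covers? : ∀ {m} τ (ms : Vec A m) → Dec (Covers τ ms)
  covers? τ ms = all? (λ a → mult a ms ℕ.≟ 1) τ

  opaque
    cov : ∀ {m} → List A → Vec A m → ℤ
    cov τ ms = 𝟙 (covers? τ ms)

    cov-↭ : ∀ {m} τ {ms ns : Vec A m} → ms ↭ ns → cov τ ms ≡ cov τ ns
    cov-↭ τ {ms} {ns} p = 𝟙-⇔ (covers? τ ms) (covers? τ ns)
      (All.map λ {a} eq → trans (sym (mult-↭ a p)) eq) (All.map λ {a} eq → trans (mult-↭ a p) eq)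

    cov-missed : ∀ {m a τ} {ms : Vec A m} → a ∈ τ → AllVec (a ≢_) ms → cov τ ms ≡ 0ℤ
    cov-missed {a = a} {τ} {ms} a∈τ a≢ms = 𝟙-no (covers? τ ms) λ c →
      ℕ.1+n≢0 (trans (sym (All.lookup c a∈τ)) (mult-0 a≢ms))

    cov-repeated : ∀ {m a τ} {ms : Vec A (suc (suc m))} {ns : Vec A m} → a ∈ τ → ms ↭ a ∷ a ∷ ns → cov τ ms ≡ 0ℤ
    cov-repeated {a = a} {τ} {ms} {ns} a∈τ p = 𝟙-no (covers? τ ms) λ c →
      ℕ.0≢1+n (ℕ.suc-injective (trans (sym (All.lookup c a∈τ))
        (trans (mult-↭ a p) (trans (mult-≡ {ms = a ∷ ns} refl) (cong suc (mult-≡ {ms = ns} refl))))))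

    cov-cut : ∀ {m v τ} {ms : Vec A m} → v ∉ τ → AllVec (v ≢_) ms → cov (v ∷ τ) (v ∷ ms) ≡ cov τ ms
    cov-cut {v = v} {τ} {ms} v∉τ v≢ms = 𝟙-⇔ (covers? (v ∷ τ) (v ∷ ms)) (covers? τ ms) to from
      where
      old : ∀ {a} → a ∈ τ → mult a (v ∷ ms) ≡ mult a ms
      old a∈τ = mult-≢ {ms = ms} λ { refl → v∉τ a∈τ }

      to : Covers (v ∷ τ) (v ∷ ms) → Covers τ ms
      to (_ ∷ c) = All.tabulate λ a∈τ → trans (sym (old a∈τ)) (All.lookup c a∈τ)

      from : Covers τ ms → Covers (v ∷ τ) (v ∷ ms)
      from c = trans (mult-≡ {ms = ms} refl) (cong suc (mult-0 v≢ms)) ∷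
               All.tabulate λ a∈τ → trans (old a∈τ) (All.lookup c a∈τ)

    cov≡𝟙 : ∀ {m} τ (ms : Vec A m) → cov τ ms ≡ 𝟙 (covers? τ ms)
    cov≡𝟙 τ ms = refl

  -- An F : Vec Bool k is the spanning forest keeping the edge from v to u of
  -- every layer sprout v u marked true; a component is named by its vertex
  -- nearest to the seed.

  rep : ∀ {k} → Tree A k → Vec Bool k → A → A
  rep (seed r)       []      x = x
  rep (sprout v u t) (b ∷ F) x =
    if does (x ≟ v) then (if b then rep t F u else v) else rep t F x

  tops : ∀ {k} → Tree A k → Vec Bool k → List A
  tops (seed r)       []          = [ r ]
  tops (sprout v u t) (true  ∷ F) = tops t F
  tops (sprout v u t) (false ∷ F) = v ∷ tops t F

  -- The number of cut edges that leave the component `a`. In a tree they end in different outside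
  -- vertices, so this is the boundary degree, as `counts-border` shows.
  cutDegree : ∀ {k} → Tree A k → Vec Bool k → A → ℕ
  cutDegree (seed r)       []          a = 0
  cutDegree (sprout v u t) (true  ∷ F) a = cutDegree t F a
  cutDegree (sprout v u t) (false ∷ F) a =
    if does (a ≟ v) then 1
    else if does (a ≟ rep t F u) then suc (cutDegree t F a) else cutDegree t F a

  module _ {k} {v u : A} (t : Tree A k) where

    rep-old : ∀ {x} b F → x ≢ v → rep (sprout v u t) (b ∷ F) x ≡ rep t F x
    rep-old {x} b F x≢v rewrite dec-false (x ≟ v) x≢v = refl

    rep-joined : ∀ F → rep (sprout v u t) (true ∷ F) v ≡ rep t F u
    rep-joined F rewrite dec-true (v ≟ v) refl = refl

    rep-cut : ∀ F → rep (sprout v u t) (false ∷ F) v ≡ v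
    rep-cut F rewrite dec-true (v ≟ v) refl = refl

    cutDegree-leaf : ∀ F → cutDegree (sprout v u t) (false ∷ F) v ≡ 1
    cutDegree-leaf F rewrite dec-true (v ≟ v) refl = refl

    cutDegree-old : ∀ F {a} → a ≢ v →
      + cutDegree (sprout v u t) (false ∷ F) a ≡ + cutDegree t F a + 𝟙 (a ≟ rep t F u)
    cutDegree-old F {a} a≢v rewrite dec-false (a ≟ v) a≢v with does (a ≟ rep t F u)
    ... | true  = cong +_ (ℕ.+-comm 1 _)
    ... | false = sym (ℤ.+-identityʳ _)

  rep∈tops : ∀ {k} (t : Tree A k) F {x} → Valid t → x ∈ verts t → rep t F x ∈ tops t F
  rep∈tops (seed r) [] _ x∈ = x∈
  rep∈tops (sprout v u t) (b ∷ F) {x} (v∉ , u∈ , V) x∈ with x ≟ v | b | x∈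
  ... | yes _  | true  | _        = rep∈tops t F V u∈
  ... | yes _  | false | _        = here refl
  ... | no x≢v | _     | here x≡v = ⊥-elim (x≢v x≡v)
  ... | no _   | true  | there x∈ = rep∈tops t F V x∈
  ... | no _   | false | there x∈ = there (rep∈tops t F V x∈)

  tops⊆verts : ∀ {k} (t : Tree A k) F {a} → a ∈ tops t F → a ∈ verts t
  tops⊆verts (seed r)       []          a∈         = a∈
  tops⊆verts (sprout v u t) (true  ∷ F) a∈         = there (tops⊆verts t F a∈)
  tops⊆verts (sprout v u t) (false ∷ F) (here eq)  = here eq
  tops⊆verts (sprout v u t) (false ∷ F) (there a∈) = there (tops⊆verts t F a∈)

  tops-unique : ∀ {k} (t : Tree A k) F → Valid t → Unique (tops t F)
  tops-unique (seed r)       []          _            = [] ∷ []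
  tops-unique (sprout v u t) (true  ∷ F) (_ , _ , V)  = tops-unique t F V
  tops-unique (sprout v u t) (false ∷ F) (v∉ , _ , V) =
    All.tabulate (λ { a∈ refl → v∉ (tops⊆verts t F a∈) }) ∷ tops-unique t F V

  over : ∀ {k m} → Tree A k → Vec A m → Set
  over t = AllVec (_∈ verts t)

  reps : ∀ {k m} → Tree A k → Vec Bool k → Vec A m → Vec A m
  reps t F = Vec.map (rep t F)

  ψ φ : ℤ → ℤ
  ψ δ = δ - + 2
  φ δ = (δ - + 1) * (δ - + 4)

  module _ {k m} (t : Tree A k) (S : Vec A m) where

    rooted : ℤ
    rooted = ∑ λ F → cov (tops t F) (reps t F S)

    -- Since `x` is added to the marks, its component contains no vertex of `S` and floats; `y` is
    -- no further mark and only has to share that component.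
    joint : A → A → ℤ
    joint x y = ∑ λ F → cov (tops t F) (reps t F (x ∷ S)) * 𝟙 (rep t F x ≟ rep t F y)

    floatingAt : A → ℤ
    floatingAt w = ∑ λ F → cov (tops t F) (reps t F (w ∷ S)) * ψ (+ cutDegree t F (rep t F w))

    floatingΣ : ℤ
    floatingΣ = ∑ λ F → sumOver (tops t F) λ a → cov (tops t F) (a ∷ reps t F S) * φ (+ cutDegree t F a)

-- Recursions of the forest counts at a leaf

module Recursion {A : Set} (_≟_ : DecidableEquality A) where
  open Forests _≟_

  module _ {k} (t : Tree A k) (V : Valid t) where

    rooted-↭ : ∀ {m} {S S′ : Vec A m} → S ↭ S′ → rooted t S ≡ rooted t S′
    rooted-↭ p = ∑-cong λ F → cov-↭ (tops t F) (↭-map (rep t F) p)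

    joint-↭ : ∀ {m} {S S′ : Vec A m} x y → S ↭ S′ → joint t S x y ≡ joint t S′ x y
    joint-↭ x y p = ∑-cong λ F →
      cong (_* 𝟙 (rep t F x ≟ rep t F y)) (cov-↭ (tops t F) (↭-prep (rep t F x) (↭-map (rep t F) p)))

    floatingAt-↭ : ∀ {m} {S S′ : Vec A m} w → S ↭ S′ → floatingAt t S w ≡ floatingAt t S′ w
    floatingAt-↭ w p = ∑-cong λ F →
      cong (_* ψ (+ cutDegree t F (rep t F w))) (cov-↭ (tops t F) (↭-prep (rep t F w) (↭-map (rep t F) p)))

    floatingΣ-↭ : ∀ {m} {S S′ : Vec A m} → S ↭ S′ → floatingΣ t S ≡ floatingΣ t S′
    floatingΣ-↭ p = ∑-cong λ F → sumOver-cong (tops t F) λ {a} _ →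
      cong (_* φ (+ cutDegree t F a)) (cov-↭ (tops t F) (↭-prep a (↭-map (rep t F) p)))

    cov-repeat : ∀ {m z} {S : Vec A (suc (suc m))} {S′ : Vec A m} F → z ∈ verts t → S ↭ z ∷ z ∷ S′ →
      cov (tops t F) (reps t F S) ≡ 0ℤ
    cov-repeat F z∈ p = cov-repeated (rep∈tops t F V z∈) (↭-map (rep t F) p)

    rooted-repeat : ∀ {m z} {S : Vec A (suc (suc m))} {S′ : Vec A m} → z ∈ verts t → S ↭ z ∷ z ∷ S′ →
      rooted t S ≡ 0ℤ
    rooted-repeat z∈ p = ∑-0 λ F → cov-repeat F z∈ p

    floatingAt-repeat : ∀ {m z w} {S : Vec A (suc m)} {S′ : Vec A m} → z ∈ verts t → w ∷ S ↭ z ∷ z ∷ S′ →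
      floatingAt t S w ≡ 0ℤ
    floatingAt-repeat {w = w} z∈ p = ∑-0 λ F → cong (_* ψ (+ cutDegree t F (rep t F w))) (cov-repeat F z∈ p)

    joint-repeatˡ : ∀ {m z x y} {S : Vec A (suc m)} {S′ : Vec A m} → z ∈ verts t → x ∷ S ↭ z ∷ z ∷ S′ →
      joint t S x y ≡ 0ℤ
    joint-repeatˡ {x = x} {y} z∈ p = ∑-0 λ F → cong (_* 𝟙 (rep t F x ≟ rep t F y)) (cov-repeat F z∈ p)

    -- Where the indicator is nonzero, `x` and `y` have the same representative, so `y` may replace
    -- `x` among the marks and the repetition becomes visible to `cov`.
    joint-repeatʳ : ∀ {m z x y} {S : Vec A (suc m)} {S′ : Vec A m} → z ∈ verts t → y ∷ S ↭ z ∷ z ∷ S′ →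
      joint t S x y ≡ 0ℤ
    joint-repeatʳ {x = x} {y} {S} z∈ p = ∑-0 λ F → vanish F (rep t F x ≟ rep t F y)
      where
      vanish : ∀ F (x≟y : Dec (rep t F x ≡ rep t F y)) → cov (tops t F) (reps t F (x ∷ S)) * 𝟙 x≟y ≡ 0ℤ
      vanish F (yes eq) = cong (_* 1ℤ)
        (trans (cong (λ r → cov (tops t F) (r ∷ reps t F S)) eq) (cov-repeat F z∈ p))
      vanish F (no _)   = ℤ.*-zeroʳ (cov (tops t F) (reps t F (x ∷ S)))

    floatingΣ-repeat : ∀ {m z} {S : Vec A (suc (suc m))} {S′ : Vec A m} → z ∈ verts t → S ↭ z ∷ z ∷ S′ →
      floatingΣ t S ≡ 0ℤ
    floatingΣ-repeat {z = z} z∈ p = ∑-0 λ F → sumOver-0 (tops t F) λ {a} a∈ →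
      cong (_* φ (+ cutDegree t F a))
        (cov-repeated (rep∈tops t F V z∈)
          (↭-trans (↭-prep a (↭-map (rep t F) p))
                   (↭-trans (↭-swap a (rep t F z)) (↭-prep (rep t F z) (↭-swap a (rep t F z))))))

  module Layer {k} (v u : A) (t : Tree A k) (valid : Valid (sprout v u t)) where

    private
      t⁺ : Tree A (suc k)
      t⁺ = sprout v u t

      v∉ : v ∉ verts t
      v∉ = proj₁ valid

      V : Valid t
      V = proj₂ (proj₂ valid)

      old≢v : ∀ {x} → x ∈ verts t → x ≢ v
      old≢v x∈ refl = v∉ x∈

      v∉tops : ∀ F → v ∉ tops t F
      v∉tops F v∈ = v∉ (tops⊆verts t F v∈)

      reps-old : ∀ {m} {S : Vec A m} b F → over t S → reps t⁺ (b ∷ F) S ≡ reps t F S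
      reps-old b F []       = refl
      reps-old b F (x∈ ∷ S) = cong₂ _∷_ (rep-old t b F (old≢v x∈)) (reps-old b F S)

      joined : ∀ {m} {S : Vec A m} F → over t S → reps t⁺ (true ∷ F) (v ∷ S) ≡ reps t F (u ∷ S)
      joined F S = cong₂ _∷_ (rep-joined t F) (reps-old true F S)

      cut : ∀ {m} {S : Vec A m} F → over t S → reps t⁺ (false ∷ F) (v ∷ S) ≡ v ∷ reps t F S
      cut F S = cong₂ _∷_ (rep-cut {u = u} t F) (reps-old false F S)

      joined′ : ∀ {m x} {S : Vec A m} F → x ∈ verts t → over t S →
        reps t⁺ (true ∷ F) (x ∷ v ∷ S) ≡ reps t F (x ∷ u ∷ S)
      joined′ F x∈ S = cong₂ _∷_ (rep-old t true F (old≢v x∈)) (joined F S)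

      rep≢v : ∀ {x} F → x ∈ verts t → v ≢ rep t F x
      rep≢v F x∈ eq = v∉tops F (subst (_∈ tops t F) (sym eq) (rep∈tops t F V x∈))

      reps≢v : ∀ {m} {S : Vec A m} F → over t S → AllVec (v ≢_) (reps t F S)
      reps≢v F []       = []
      reps≢v F (x∈ ∷ S) = rep≢v F x∈ ∷ reps≢v F S

      -- Once its edge is cut, `v` is a component by itself and needs a mark, but all marks are old
      -- vertices.
      missed : ∀ {m} {S : Vec A m} F → over t S → cov (tops t⁺ (false ∷ F)) (reps t⁺ (false ∷ F) S) ≡ 0ℤ
      missed F S = trans (cong (cov (tops t⁺ (false ∷ F))) (reps-old false F S))
                         (cov-missed (here refl) (reps≢v F S))

      cov-cut₁ : ∀ {m} {S : Vec A m} F → over t S →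
        cov (tops t⁺ (false ∷ F)) (reps t⁺ (false ∷ F) (v ∷ S)) ≡ cov (tops t F) (reps t F S)
      cov-cut₁ F S = trans (cong (cov (tops t⁺ (false ∷ F))) (cut F S)) (cov-cut (v∉tops F) (reps≢v F S))

      cov-cut₂ : ∀ {m a} {S : Vec A m} F → v ≢ a → over t S →
        cov (v ∷ tops t F) (a ∷ reps t⁺ (false ∷ F) (v ∷ S)) ≡ cov (tops t F) (a ∷ reps t F S)
      cov-cut₂ {a = a} {S} F v≢a o = begin
        cov (v ∷ tops t F) (a ∷ reps t⁺ (false ∷ F) (v ∷ S))
          ≡⟨ cong (λ ms → cov (v ∷ tops t F) (a ∷ ms)) (cut F o) ⟩
        cov (v ∷ tops t F) (a ∷ v ∷ reps t F S)
          ≡⟨ cov-↭ (v ∷ tops t F) (↭-swap a v) ⟩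
        cov (v ∷ tops t F) (v ∷ a ∷ reps t F S)
          ≡⟨ cov-cut (v∉tops F) (v≢a ∷ reps≢v F o) ⟩
        cov (tops t F) (a ∷ reps t F S) ∎

      split : ∀ {f : Vec Bool (suc k) → ℤ} {g h} → (∀ F → f (false ∷ F) ≡ g F) → (∀ F → f (true ∷ F) ≡ h F) →
        ∑ f ≡ ∑ h + ∑ g
      split {f} f₀ f₁ = trans (∑-suc f) (cong₂ _+_ (∑-cong f₁) (∑-cong f₀))

      split₀ : ∀ {f : Vec Bool (suc k) → ℤ} {h} → (∀ F → f (false ∷ F) ≡ 0ℤ) → (∀ F → f (true ∷ F) ≡ h F) →
        ∑ f ≡ ∑ h
      split₀ {f} f₀ f₁ = trans (∑-suc f) (trans (cong₂ _+_ (∑-cong f₁) (∑-0 f₀)) (ℤ.+-identityʳ _))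

    module _ {m} {S : Vec A m} (S⊆ : over t S) where

      rooted-old : rooted t⁺ S ≡ rooted t S
      rooted-old = split₀ (λ F → missed F S⊆) λ F → cong (cov (tops t F)) (reps-old true F S⊆)

      -- Keeping the edge puts the mark `v` into the component of `u`; cutting it leaves `v` as its
      -- own root and an `S`-rooted forest of `t`.
      rooted-new : rooted t⁺ (v ∷ S) ≡ rooted t (u ∷ S) + rooted t S
      rooted-new = split (λ F → cov-cut₁ F S⊆) λ F → cong (cov (tops t F)) (joined F S⊆)

      joint-old : ∀ {x y} → x ∈ verts t → y ∈ verts t → joint t⁺ S x y ≡ joint t S x y
      joint-old {x} {y} x∈ y∈ = split₀
        (λ F → cong (_* 𝟙 (rep t⁺ (false ∷ F) x ≟ rep t⁺ (false ∷ F) y)) (missed F (x∈ ∷ S⊆)))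
        (λ F → cong₂ _*_ (cong (cov (tops t F)) (reps-old true F (x∈ ∷ S⊆)))
                         (cong₂ (λ a b → 𝟙 (a ≟ b)) (rep-old t true F (old≢v x∈)) (rep-old t true F (old≢v y∈))))

      -- If the edge is cut, the floating component is `v` alone and cannot contain `y`.
      joint-leafˡ : ∀ {y} → y ∈ verts t → joint t⁺ S v y ≡ joint t S u y
      joint-leafˡ {y} y∈ = split₀
        (λ F → trans (cong (cov (tops t⁺ (false ∷ F)) (reps t⁺ (false ∷ F) (v ∷ S)) *_)
                       (trans (cong₂ (λ a b → 𝟙 (a ≟ b)) (rep-cut {u = u} t F) (rep-old {u = u} t false F (old≢v y∈)))
                              (𝟙-no (v ≟ rep t F y) (rep≢v F y∈))))
                     (ℤ.*-zeroʳ (cov (tops t⁺ (false ∷ F)) (reps t⁺ (false ∷ F) (v ∷ S)))))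
        (λ F → cong₂ _*_ (cong (cov (tops t F)) (joined F S⊆))
                         (cong₂ (λ a b → 𝟙 (a ≟ b)) (rep-joined t F) (rep-old t true F (old≢v y∈))))

      joint-leafʳ : ∀ {x} → x ∈ verts t → joint t⁺ S x v ≡ joint t S x u
      joint-leafʳ {x} x∈ = split₀
        (λ F → cong (_* 𝟙 (rep t⁺ (false ∷ F) x ≟ rep t⁺ (false ∷ F) v)) (missed F (x∈ ∷ S⊆)))
        (λ F → cong₂ _*_ (cong (cov (tops t F)) (reps-old true F (x∈ ∷ S⊆)))
                         (cong₂ (λ a b → 𝟙 (a ≟ b)) (rep-old t true F (old≢v x∈)) (rep-joined t F)))

      -- If the edge is cut, `v` floats alone and the rest is an `S`-rooted forest of `t`.
      joint-leaf : joint t⁺ S v v ≡ joint t S u u + rooted t S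
      joint-leaf = split
        (λ F → trans (cong₂ _*_ (cov-cut₁ F S⊆) (𝟙-yes (rep t⁺ (false ∷ F) v ≟ rep t⁺ (false ∷ F) v) refl))
                     (ℤ.*-identityʳ _))
        (λ F → cong₂ _*_ (cong (cov (tops t F)) (joined F S⊆))
                         (cong₂ (λ a b → 𝟙 (a ≟ b)) (rep-joined t F) (rep-joined t F)))

      joint-new : ∀ {x y} → x ∈ verts t → y ∈ verts t →
        joint t⁺ (v ∷ S) x y ≡ joint t (u ∷ S) x y + joint t S x y
      joint-new {x} {y} x∈ y∈ = split
        (λ F → cong₂ _*_ (trans (cong (λ r → cov (tops t⁺ (false ∷ F)) (r ∷ reps t⁺ (false ∷ F) (v ∷ S)))
                                      (rep-old {u = u} t false F (old≢v x∈)))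
                                (cov-cut₂ F (rep≢v F x∈) S⊆))
                         (cong₂ (λ a b → 𝟙 (a ≟ b)) (rep-old {u = u} t false F (old≢v x∈)) (rep-old {u = u} t false F (old≢v y∈))))
        (λ F → cong₂ _*_ (cong (cov (tops t F)) (joined′ F x∈ S⊆))
                         (cong₂ (λ a b → 𝟙 (a ≟ b)) (rep-old t true F (old≢v x∈)) (rep-old t true F (old≢v y∈))))

      floatingAt-old : ∀ {w} → w ∈ verts t → floatingAt t⁺ S w ≡ floatingAt t S w
      floatingAt-old {w} w∈ = split₀
        (λ F → cong (_* ψ (+ cutDegree t⁺ (false ∷ F) (rep t⁺ (false ∷ F) w))) (missed F (w∈ ∷ S⊆)))
        (λ F → cong₂ _*_ (cong (cov (tops t F)) (reps-old true F (w∈ ∷ S⊆)))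
                         (cong (λ a → ψ (+ cutDegree t F a)) (rep-old t true F (old≢v w∈))))

      -- If the edge is cut, `v` floats alone with degree 1, and `ψ 1` is -1.
      floatingAt-leaf : floatingAt t⁺ S v ≡ floatingAt t S u - rooted t S
      floatingAt-leaf = trans
        (split {g = λ F → -1ℤ * cov (tops t F) (reps t F S)}
          (λ F → trans (cong₂ _*_ (cov-cut₁ F S⊆)
                         (trans (cong (λ a → ψ (+ cutDegree t⁺ (false ∷ F) a)) (rep-cut {u = u} t F))
                                (cong (λ d → ψ (+ d)) (cutDegree-leaf t F))))
                       (ℤ.*-comm (cov (tops t F) (reps t F S)) -1ℤ))
          (λ F → cong₂ _*_ (cong (cov (tops t F)) (joined F S⊆))
                           (cong (λ a → ψ (+ cutDegree t F a)) (rep-joined t F))))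
        (cong (_+_ (floatingAt t S u))
              (trans (∑-* -1ℤ (λ F → cov (tops t F) (reps t F S))) (ℤ.-1*i≡-i (rooted t S))))

      -- The cut edge raises the degree of the floating component exactly if `u` lies in it, and
      -- then `ψ` grows by 1. The forests in which this happens are counted by `joint t S w u`.
      floatingAt-new : ∀ {w} → w ∈ verts t →
        floatingAt t⁺ (v ∷ S) w ≡ floatingAt t (u ∷ S) w + (floatingAt t S w + joint t S w u)
      floatingAt-new {w} w∈ = trans
        (split
          (λ F → trans (cong₂ _*_
              (trans (cong (λ r → cov (tops t⁺ (false ∷ F)) (r ∷ reps t⁺ (false ∷ F) (v ∷ S)))
                           (rep-old {u = u} t false F (old≢v w∈)))
                     (cov-cut₂ F (rep≢v F w∈) S⊆))
              (cong ψ (trans (cong (λ a → + cutDegree t⁺ (false ∷ F) a) (rep-old {u = u} t false F (old≢v w∈)))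
                             (cutDegree-old t F (rep≢v F w∈ ∘ sym)))))
            (expand (cov (tops t F) (reps t F (w ∷ S))) (+ cutDegree t F (rep t F w)) (𝟙 (rep t F w ≟ rep t F u))))
          (λ F → cong₂ _*_ (cong (cov (tops t F)) (joined′ F w∈ S⊆))
                           (cong (λ a → ψ (+ cutDegree t F a)) (rep-old t true F (old≢v w∈)))))
        (cong (_+_ (floatingAt t (u ∷ S) w)) (∑-+ _ _))
        where
        expand : ∀ c d i → c * (d + i - + 2) ≡ c * (d - + 2) + c * i
        expand = solve-∀

      -- If the edge is cut, only `v` itself can float, with degree 1, and `φ 1` is 0.
      floatingΣ-old : floatingΣ t⁺ S ≡ floatingΣ t S
      floatingΣ-old = split₀
        (λ F → cong₂ _+_
          (trans (cong (λ d → cov (v ∷ tops t F) (v ∷ reps t⁺ (false ∷ F) S) * φ (+ d)) (cutDegree-leaf t F))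
                 (ℤ.*-zeroʳ (cov (v ∷ tops t F) (v ∷ reps t⁺ (false ∷ F) S))))
          (sumOver-0 (tops t F) λ {a} a∈ → cong (_* φ (+ cutDegree t⁺ (false ∷ F) a))
            (trans (cong (λ ms → cov (v ∷ tops t F) (a ∷ ms)) (reps-old false F S⊆))
                   (cov-missed (here refl) ((λ { refl → v∉tops F a∈ }) ∷ reps≢v F S⊆)))))
        (λ F → cong (λ ms → sumOver (tops t F) λ a → cov (tops t F) (a ∷ ms) * φ (+ cutDegree t F a))
                    (reps-old true F S⊆))

      -- If the edge is cut, the marked `v` cannot float, and among the old components only that of
      -- `u` gains a boundary vertex. The increment therefore survives at one term of the sum, where
      -- it is twice the summand of `floatingAt t S u`.
      floatingΣ-new : floatingΣ t⁺ (v ∷ S) ≡ floatingΣ t (u ∷ S) + (floatingΣ t S + + 2 * floatingAt t S u)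
      floatingΣ-new = trans
        (split
          (λ F → trans (cong₂ _+_
              (cong (_* φ (+ cutDegree t⁺ (false ∷ F) v))
                (trans (cong (λ ms → cov (v ∷ tops t F) (v ∷ ms)) (cut F S⊆))
                       (cov-repeated (here refl) ↭-refl)))
              (sumOver-cong (tops t F) λ {a} a∈ → trans (cong₂ _*_
                 (cov-cut₂ F (λ { refl → v∉tops F a∈ }) S⊆)
                 (cong φ (cutDegree-old t F λ { refl → v∉tops F a∈ })))
                 (difference (a ≟ rep t F u) (cov (tops t F) (a ∷ reps t F S)) (+ cutDegree t F a))))
            (trans (ℤ.+-identityˡ _)
              (trans (sumOver-+ (tops t F) _ _)
                (cong (_+_ (sumOver (tops t F) λ a → cov (tops t F) (a ∷ reps t F S) * φ (+ cutDegree t F a)))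
                  (sumOver-select _≟_ (tops-unique t F V) (rep∈tops t F V (proj₁ (proj₂ valid)))
                    (λ a → + 2 * (cov (tops t F) (a ∷ reps t F S) * ψ (+ cutDegree t F a))))))))
          (λ F → cong (λ ms → sumOver (tops t F) λ a → cov (tops t F) (a ∷ ms) * φ (+ cutDegree t F a))
                      (joined F S⊆)))
        (cong (_+_ (floatingΣ t (u ∷ S)))
          (trans (∑-+ (λ F → sumOver (tops t F) λ a → cov (tops t F) (a ∷ reps t F S) * φ (+ cutDegree t F a)) _)
                 (cong (_+_ (floatingΣ t S)) (∑-* (+ 2) _))))
        where
        -- φ (δ + 1) = φ δ + 2 ψ δ
        difference : ∀ {P : Set} (P? : Dec P) c d → c * φ (d + 𝟙 P?) ≡ c * φ d + 𝟙 P? * (+ 2 * (c * ψ d))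
        difference (yes _) = plus
          where
          plus : ∀ c d → c * ((d + 1ℤ - + 1) * (d + 1ℤ - + 4)) ≡
                         c * ((d - + 1) * (d - + 4)) + 1ℤ * (+ 2 * (c * (d - + 2)))
          plus = solve-∀
        difference (no _)  = same
          where
          same : ∀ c d → c * ((d + 0ℤ - + 1) * (d + 0ℤ - + 4)) ≡
                         c * ((d - + 1) * (d - + 4)) + 0ℤ * (+ 2 * (c * (d - + 2)))
          same = solve-∀

-- Minors of the bordered distance matrix

sign-map : ∀ {X Y : Set} (f : X → Y) {m} {xs ys : Vec X m} (p : xs ↭ ys) → sign (↭-map f p) ≡ sign p
sign-map f ↭-refl        = refl
sign-map f (↭-prep x p)  = sign-map f p
sign-map f (↭-swap x y)  = refl
sign-map f (↭-trans p q) = cong₂ _*_ (sign-map f p) (sign-map f q)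

module Minors {A : Set} (_≟_ : DecidableEquality A) (d : A → A → ℤ)
  (d-self : ∀ x → d x x ≡ 0ℤ) (d-sym : ∀ x y → d x y ≡ d y x) where

  open Forests _≟_
  open Recursion _≟_

  D∞ : Maybe A → Maybe A → ℤ
  D∞ nothing  nothing  = 0ℤ
  D∞ nothing  (just y) = 1ℤ
  D∞ (just x) nothing  = 1ℤ
  D∞ (just x) (just y) = d x y

  D∞-sym : ∀ x y → D∞ x y ≡ D∞ y x
  D∞-sym nothing  nothing  = refl
  D∞-sym nothing  (just y) = refl
  D∞-sym (just x) nothing  = refl
  D∞-sym (just x) (just y) = d-sym x y

  open Bracket D∞ D∞-sym

  ∞ : Maybe A
  ∞ = nothing

  _⁺ : ∀ {m} → Vec A m → Vec (Maybe A) m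
  S ⁺ = Vec.map just S

  Metric : ∀ {k} → Tree A k → Set
  Metric (seed r)       = 𝟏
  Metric (sprout v u t) = (∀ {y} → y ∈ verts t → d v y ≡ d u y + 1ℤ) × Metric t

  data Occurrences {k} (v : A) (t : Tree A k) : ∀ {m} → Vec A m → Set where
    none : ∀ {m} {S : Vec A m} → over t S → Occurrences v t S
    once : ∀ {m} {S : Vec A (suc m)} S′ → S ↭ v ∷ S′ → over t S′ → Occurrences v t S
    more : ∀ {m} {S : Vec A (suc (suc m))} S′ → S ↭ v ∷ v ∷ S′ → Occurrences v t S

  occurrences : ∀ {k m} v u (t : Tree A k) {S : Vec A m} → over (sprout v u t) S → Occurrences v t S
  occurrences v u t [] = none []
  occurrences v u t (here refl ∷ o) with occurrences v u t o
  ... | none o′      = once _ ↭-refl o′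
  ... | once S′ p o′ = more S′ (↭-prep v p)
  ... | more S′ p    = more (v ∷ S′) (↭-prep v p)
  occurrences v u t {x ∷ S} (there x∈ ∷ o) with occurrences v u t o
  ... | none o′      = none (x∈ ∷ o′)
  ... | once S′ p o′ = once (x ∷ S′) (↭-trans (↭-prep x p) (↭-swap x v)) (x∈ ∷ o′)
  ... | more S′ p    = more (x ∷ S′) (↭-trans (↭-prep x p) (↭-trans (↭-swap x v) (↭-prep v (↭-swap x v))))

  plain bordered : ∀ {m} → Vec A m → ℤ
  plain    S = ⟦ S ⁺ ∣ S ⁺ ⟧
  bordered S = ⟦ ∞ ∷ S ⁺ ∣ ∞ ∷ S ⁺ ⟧

  mixed : ∀ {m} → Vec A m → A → ℤ
  mixed S w = ⟦ ∞ ∷ S ⁺ ∣ just w ∷ S ⁺ ⟧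

  bordered₂ : ∀ {m} → Vec A m → A → A → ℤ
  bordered₂ S x y = ⟦ ∞ ∷ just x ∷ S ⁺ ∣ ∞ ∷ just y ∷ S ⁺ ⟧

  module _ {m} {S S′ : Vec A m} (p : S ↭ S′) where

    private
      p⁺ : S ⁺ ↭ S′ ⁺
      p⁺ = ↭-map just p

    plain-↭ : plain S ≡ plain S′
    plain-↭ = both-↭ p⁺ p⁺ refl

    bordered-↭ : bordered S ≡ bordered S′
    bordered-↭ = both-↭ (↭-prep ∞ p⁺) (↭-prep ∞ p⁺) refl

    mixed-↭ : ∀ w → mixed S w ≡ mixed S′ w
    mixed-↭ w = both-↭ (↭-prep ∞ p⁺) (↭-prep (just w) p⁺) refl

    bordered₂-↭ : ∀ x y → bordered₂ S x y ≡ bordered₂ S′ x y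
    bordered₂-↭ x y = both-↭ (↭-prep ∞ (↭-prep (just x) p⁺)) (↭-prep ∞ (↭-prep (just y) p⁺)) refl

  to-front : ∀ {X : Set} {m} a z {zs : Vec X m} → a ∷ z ∷ z ∷ zs ↭ z ∷ z ∷ a ∷ zs
  to-front a z = ↭-trans (↭-swap a z) (↭-prep z (↭-swap a z))

  plain-repeat : ∀ {m z} {S : Vec A (suc (suc m))} {S′ : Vec A m} → S ↭ z ∷ z ∷ S′ → plain S ≡ 0ℤ
  plain-repeat {S = S} p = repeatedRow (S ⁺) (↭-map just p)

  bordered-repeat : ∀ {m z} {S : Vec A (suc (suc m))} {S′ : Vec A m} → S ↭ z ∷ z ∷ S′ → bordered S ≡ 0ℤ
  bordered-repeat {z = z} {S} p =
    repeatedRow (∞ ∷ S ⁺) (↭-trans (↭-prep ∞ (↭-map just p)) (to-front ∞ (just z)))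

  mixed-repeat : ∀ {m w z} {S : Vec A (suc m)} {S′ : Vec A m} → w ∷ S ↭ z ∷ z ∷ S′ → mixed S w ≡ 0ℤ
  mixed-repeat {S = S} p = repeatedColumn (∞ ∷ S ⁺) (↭-map just p)

  bordered₂-repeatˡ : ∀ {m x y z} {S : Vec A (suc m)} {S′ : Vec A m} → x ∷ S ↭ z ∷ z ∷ S′ → bordered₂ S x y ≡ 0ℤ
  bordered₂-repeatˡ {y = y} {z} {S} p =
    repeatedRow (∞ ∷ just y ∷ S ⁺) (↭-trans (↭-prep ∞ (↭-map just p)) (to-front ∞ (just z)))

  bordered₂-repeatʳ : ∀ {m x y z} {S : Vec A (suc m)} {S′ : Vec A m} → y ∷ S ↭ z ∷ z ∷ S′ → bordered₂ S x y ≡ 0ℤ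
  bordered₂-repeatʳ {x = x} {z = z} {S} p =
    repeatedColumn (∞ ∷ just x ∷ S ⁺) (↭-trans (↭-prep ∞ (↭-map just p)) (to-front ∞ (just z)))

  module LeafRules {k} (v u : A) (t : Tree A k) (u∈ : u ∈ verts t)
    (leaf : ∀ {y} → y ∈ verts t → d v y ≡ d u y + 1ℤ) where

    private
      -- The leaf relation between rows `v`, `u` and `∞`, read in column `y`. It also holds in
      -- column `∞`, where it says 1 = 1 + 0; hence the many `refl ∷ rules S⊆` below.
      Rule : Maybe A → Set
      Rule y = D∞ (just v) y ≡ D∞ (just u) y + D∞ ∞ y

      rule : ∀ {y} → y ∈ verts t → Rule (just y)
      rule y∈ = leaf y∈

      rules : ∀ {m} {S : Vec A m} → over t S → AllVec Rule (S ⁺)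
      rules o = AllVec.map⁺ (AllVec.map rule o)

      at : ∀ {P : Maybe A → Set} {m} {xs : Vec (Maybe A) m} → AllVec P xs → ∀ j → P (lookup xs j)
      at (p ∷ _)  zero    = p
      at (_ ∷ ps) (suc j) = at ps j

      -- In column `v` the relation fails: the entry is 0, whereas d u v + 1 = 2.
      corner : D∞ (just v) (just v) ≡ D∞ (just u) (just v) + D∞ ∞ (just v) + - (+ 2)
      corner = trans (d-self v) (sym (cong (λ x → x + 1ℤ + - (+ 2))
        (trans (d-sym u v) (trans (leaf u∈) (cong (_+ 1ℤ) (d-self u))))))

      leaf-column : ∀ {m} (xs : Vec (Maybe A) (suc m)) (ys : Vec (Maybe A) m) → AllVec Rule xs →
        ⟦ xs ∣ just v ∷ ys ⟧ ≡ ⟦ xs ∣ just u ∷ ys ⟧ + ⟦ xs ∣ ∞ ∷ ys ⟧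
      leaf-column xs ys r = column-additive (just v) (just u) ∞ xs ys (at r)

      leaf-corner : ∀ {m} {xs ys : Vec (Maybe A) m} → AllVec Rule ys →
        ⟦ just v ∷ xs ∣ just v ∷ ys ⟧ ≡
          ⟦ just u ∷ xs ∣ just v ∷ ys ⟧ + ⟦ ∞ ∷ xs ∣ just v ∷ ys ⟧ + - (+ 2) * ⟦ xs ∣ ys ⟧
      leaf-corner {xs = xs} {ys} r = row-additive-corner (just v) (just u) ∞ (just v) (- (+ 2)) xs ys corner (at r)

      -- Since `∞` is already a row, the summand with row `∞` in place of row `v` has two equal
      -- rows. What remains is the expansion of column `v`.
      bordered-corner : ∀ {m} {xs : Vec (Maybe A) m} {ys : Vec (Maybe A) (suc m)} →
        AllVec Rule xs → AllVec Rule ys →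
        ⟦ just v ∷ ∞ ∷ xs ∣ just v ∷ ys ⟧ ≡
          ⟦ just u ∷ ∞ ∷ xs ∣ just u ∷ ys ⟧ + ⟦ just u ∷ ∞ ∷ xs ∣ ∞ ∷ ys ⟧ + - (+ 2) * ⟦ ∞ ∷ xs ∣ ys ⟧
      bordered-corner {xs = xs} {ys} rx ry = trans (leaf-corner ry) (cong (_+ - (+ 2) * ⟦ ∞ ∷ xs ∣ ys ⟧)
        (+-vanishʳ (leaf-column (just u ∷ ∞ ∷ xs) ys (rule u∈ ∷ refl ∷ rx))
                   (repeatedRow (just v ∷ ys) (↭-refl {xs = ∞ ∷ ∞ ∷ xs}))))

      -- With `∞` on both sides, the extra row and the extra column are both repetitions. This
      -- leaves two terms, the counterparts of keeping and cutting the edge.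
      bordered-corner₂ : ∀ {m} {xs ys : Vec (Maybe A) m} → AllVec Rule xs → AllVec Rule ys →
        ⟦ ∞ ∷ just v ∷ xs ∣ ∞ ∷ just v ∷ ys ⟧ ≡
          ⟦ ∞ ∷ just u ∷ xs ∣ ∞ ∷ just u ∷ ys ⟧ + - (+ 2) * ⟦ ∞ ∷ xs ∣ ∞ ∷ ys ⟧
      bordered-corner₂ {xs = xs} {ys} rx ry =
        trans (both-↭ (↭-swap ∞ (just v)) (↭-swap ∞ (just v)) refl)
          (trans (bordered-corner rx (refl ∷ ry)) (cong (_+ - (+ 2) * ⟦ ∞ ∷ xs ∣ ∞ ∷ ys ⟧)
            (+-vanishʳ (both-↭ (↭-swap (just u) ∞) (↭-swap (just u) ∞) refl)
                       (repeatedColumn (just u ∷ ∞ ∷ xs) (↭-refl {xs = ∞ ∷ ∞ ∷ ys})))))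

    module _ {m} {S : Vec A m} (S⊆ : over t S) where

      -- Without the border nothing repeats, so expanding row `v` and then column `v` leaves four
      -- minors besides the corner. The two that contain `∞` on one side only agree by symmetry.
      plain-new : plain (v ∷ S) ≡ plain (u ∷ S) + mixed S u + (mixed S u + bordered S) + - (+ 2) * plain S
      plain-new = trans (leaf-corner (rules S⊆)) (cong (_+ - (+ 2) * plain S)
        (cong₂ _+_ (trans (leaf-column (just u ∷ S ⁺) (S ⁺) (rule u∈ ∷ rules S⊆))
                          (cong (_+_ (plain (u ∷ S))) (bracket-sym (just u ∷ S ⁺) (∞ ∷ S ⁺))))
                   (leaf-column (∞ ∷ S ⁺) (S ⁺) (refl ∷ rules S⊆))))

      bordered-new : bordered (v ∷ S) ≡ bordered (u ∷ S) + - (+ 2) * bordered S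
      bordered-new = bordered-corner₂ (rules S⊆) (rules S⊆)

      mixed-leaf : mixed S v ≡ mixed S u + bordered S
      mixed-leaf = leaf-column (∞ ∷ S ⁺) (S ⁺) (refl ∷ rules S⊆)

      -- The border is present among the rows only, so the term with rows `u`, `∞` and columns `∞`,
      -- `w` survives. Bringing `∞` to the front of the rows alone turns it into
      -- `- bordered₂ S u w`.
      mixed-new : ∀ {w} → w ∈ verts t →
        mixed (v ∷ S) w ≡ mixed (u ∷ S) w + - bordered₂ S u w + - (+ 2) * mixed S w
      mixed-new {w} w∈ = trans (both-↭ (↭-swap ∞ (just v)) (↭-swap (just w) (just v)) refl)
        (trans (bordered-corner (rules S⊆) (rule w∈ ∷ rules S⊆)) (cong (_+ - (+ 2) * mixed S w)
          (cong₂ _+_ (both-↭ (↭-swap (just u) ∞) (↭-swap (just u) (just w)) refl)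
                     (trans (rows-↭ (↭-swap (just u) ∞) (∞ ∷ just w ∷ S ⁺)) (ℤ.-1*i≡-i _)))))

      -- Column `v` is absent, so there is no corner defect, and the summand with row `∞` in place
      -- of `v` repeats a row.
      bordered₂-leafˡ : ∀ {y} → y ∈ verts t → bordered₂ S v y ≡ bordered₂ S u y
      bordered₂-leafˡ {y} y∈ = begin
        bordered₂ S v y
          ≡⟨ rows-↭ (↭-swap ∞ (just v)) (∞ ∷ just y ∷ S ⁺) ⟩
        -1ℤ * ⟦ just v ∷ ∞ ∷ S ⁺ ∣ ∞ ∷ just y ∷ S ⁺ ⟧
          ≡⟨ cong (-1ℤ *_) (trans
               (row-additive (just v) (just u) ∞ (∞ ∷ S ⁺) (∞ ∷ just y ∷ S ⁺) (at (refl ∷ rule y∈ ∷ rules S⊆)))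
               (+-vanishʳ refl (repeatedRow (∞ ∷ just y ∷ S ⁺) (↭-refl {xs = ∞ ∷ ∞ ∷ S ⁺})))) ⟩
        -1ℤ * ⟦ just u ∷ ∞ ∷ S ⁺ ∣ ∞ ∷ just y ∷ S ⁺ ⟧
          ≡⟨ rows-↭ (↭-swap ∞ (just u)) (∞ ∷ just y ∷ S ⁺) ⟨
        bordered₂ S u y ∎

      bordered₂-sym : ∀ x y → bordered₂ S x y ≡ bordered₂ S y x
      bordered₂-sym x y = bracket-sym (∞ ∷ just x ∷ S ⁺) (∞ ∷ just y ∷ S ⁺)

      bordered₂-leafʳ : ∀ {x} → x ∈ verts t → bordered₂ S x v ≡ bordered₂ S x u
      bordered₂-leafʳ {x} x∈ = trans (bordered₂-sym x v) (trans (bordered₂-leafˡ x∈) (bordered₂-sym u x))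

      bordered₂-new : ∀ {x y} → x ∈ verts t → y ∈ verts t →
        bordered₂ (v ∷ S) x y ≡ bordered₂ (u ∷ S) x y + - (+ 2) * bordered₂ S x y
      bordered₂-new {x} {y} x∈ y∈ = trans
        (both-↭ (↭-prep ∞ (↭-swap (just x) (just v))) (↭-prep ∞ (↭-swap (just y) (just v))) refl)
        (trans (bordered-corner₂ (rule x∈ ∷ rules S⊆) (rule y∈ ∷ rules S⊆))
          (cong (_+ - (+ 2) * bordered₂ S x y)
            (both-↭ (↭-prep ∞ (↭-swap (just u) (just x))) (↭-prep ∞ (↭-swap (just u) (just y))) refl)))

-- Induction over the leaf order: minors as weighted forest counts

module Invariants {A : Set} (_≟_ : DecidableEquality A) (d : A → A → ℤ)
  (d-self : ∀ x → d x x ≡ 0ℤ) (d-sym : ∀ x y → d x y ≡ d y x) where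

  open Forests _≟_
  open Recursion _≟_
  open Minors _≟_ d d-self d-sym
  open Bracket D∞ D∞-sym

  [-2]^_ : ℕ → ℤ
  [-2]^ m = (- + 2) ^ m

  -- Moving the mark `v` to `u` keeps `m`; deleting it lowers `m` by one and comes with the corner
  -- defect -2, which `[-2]^ m` absorbs. At each new leaf an identity calls only on itself and on
  -- those listed above it, all for the smaller tree.
  record Invariants {k} (t : Tree A k) : Set where
    field
      rooted-minor   : ∀ {m} {S : Vec A m} → over t S → + 2 * bordered S ≡ [-2]^ m * rooted t S
      joint-minor    : ∀ {m} {S : Vec A m} {x y} → over t S → x ∈ verts t → y ∈ verts t →
        bordered₂ S x y ≡ - ([-2]^ m * joint t S x y)
      floating-minor : ∀ {m} {S : Vec A m} {w} → over t S → w ∈ verts t →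
        + 2 * mixed S w ≡ - ([-2]^ m * floatingAt t S w)
      plain-minor    : ∀ {m} {S : Vec A m} → over t S →
        + 4 * plain S ≡ - ([-2]^ m * ((+ m - + 1) * rooted t S - floatingΣ t S))

  open Invariants

  times-0 : ∀ {a b : ℤ} c q → a ≡ 0ℤ → b ≡ 0ℤ → c * a ≡ q * b
  times-0 c q refl refl = trans (ℤ.*-zeroʳ c) (sym (ℤ.*-zeroʳ q))

  times-0⁻ : ∀ {a b : ℤ} c q → a ≡ 0ℤ → b ≡ 0ℤ → c * a ≡ - (q * b)
  times-0⁻ c q refl refl = trans (ℤ.*-zeroʳ c) (sym (cong -_ (ℤ.*-zeroʳ q)))

  zero⁻ : ∀ {a b : ℤ} q → a ≡ 0ℤ → b ≡ 0ℤ → a ≡ - (q * b)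
  zero⁻ q refl refl = sym (cong -_ (ℤ.*-zeroʳ q))

  plain-0 : ∀ {a b c : ℤ} q e → a ≡ 0ℤ → b ≡ 0ℤ → c ≡ 0ℤ → + 4 * a ≡ - (q * (e * b - c))
  plain-0 q e refl refl refl = solve-zero q e
    where
    solve-zero : ∀ q e → 0ℤ ≡ - (q * (e * 0ℤ - 0ℤ))
    solve-zero = solve-∀

  module Grow {k} (v u : A) (t : Tree A k) (valid : Valid (sprout v u t))
    (leaf : ∀ {y} → y ∈ verts t → d v y ≡ d u y + 1ℤ) (I : Invariants t) where

    private
      t⁺ = sprout v u t
      u∈ = proj₁ (proj₂ valid)

    open Layer v u t valid
    open LeafRules v u t u∈ leaf

    rooted⁺ : ∀ {m} {S : Vec A m} → over t⁺ S → + 2 * bordered S ≡ [-2]^ m * rooted t⁺ S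
    rooted⁺ {m} {S} o with occurrences v u t o
    ... | none o′ = trans (rooted-minor I o′) (cong ([-2]^ m *_) (sym (rooted-old o′)))
    ... | more S′ p = times-0 (+ 2) ([-2]^ m) (bordered-repeat p) (rooted-repeat t⁺ valid (here refl) p)
    ... | once {m′} S′ p o′ = begin
      + 2 * bordered S
        ≡⟨ cong (+ 2 *_) (trans (bordered-↭ p) (bordered-new o′)) ⟩
      + 2 * (bordered (u ∷ S′) + - (+ 2) * bordered S′)
        ≡⟨ expand (bordered (u ∷ S′)) (bordered S′) ⟩
      + 2 * bordered (u ∷ S′) + - (+ 2) * (+ 2 * bordered S′)
        ≡⟨ cong₂ (λ a b → a + - (+ 2) * b) (rooted-minor I (u∈ ∷ o′)) (rooted-minor I o′) ⟩
      - (+ 2) * q * rooted t (u ∷ S′) + - (+ 2) * (q * rooted t S′)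
        ≡⟨ collect q (rooted t (u ∷ S′)) (rooted t S′) ⟩
      - (+ 2) * q * (rooted t (u ∷ S′) + rooted t S′)
        ≡⟨ cong (- (+ 2) * q *_) (trans (rooted-↭ t⁺ valid p) (rooted-new o′)) ⟨
      - (+ 2) * q * rooted t⁺ S ∎
      where
      q = [-2]^ m′

      expand : ∀ a b → + 2 * (a + - (+ 2) * b) ≡ + 2 * a + - (+ 2) * (+ 2 * b)
      expand = solve-∀

      collect : ∀ q a b → - (+ 2) * q * a + - (+ 2) * (q * b) ≡ - (+ 2) * q * (a + b)
      collect = solve-∀

    joint⁺ : ∀ {m} {S : Vec A m} {x y} → over t⁺ S → x ∈ verts t⁺ → y ∈ verts t⁺ →
      bordered₂ S x y ≡ - ([-2]^ m * joint t⁺ S x y)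
    joint⁺ {m} {S} {x} {y} o x∈ y∈ with occurrences v u t o
    joint⁺ {m} {S} o (there x∈) (there y∈) | none o′ =
      trans (joint-minor I o′ x∈ y∈) (cong (λ a → - ([-2]^ m * a)) (sym (joint-old o′ x∈ y∈)))
    joint⁺ {m} {S} o (here refl) (there y∈) | none o′ =
      trans (bordered₂-leafˡ o′ y∈)
        (trans (joint-minor I o′ u∈ y∈) (cong (λ a → - ([-2]^ m * a)) (sym (joint-leafˡ o′ y∈))))
    joint⁺ {m} {S} o (there x∈) (here refl) | none o′ =
      trans (bordered₂-leafʳ o′ x∈)
        (trans (joint-minor I o′ x∈ u∈) (cong (λ a → - ([-2]^ m * a)) (sym (joint-leafʳ o′ x∈))))
    joint⁺ {m} {S} o (here refl) (here refl) | none o′ = begin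
      -- By definition `bordered₂ S v v` is `bordered (v ∷ S)`, so having the leaf in both places is
      -- an instance of `bordered-new`.
      bordered (v ∷ S)
        ≡⟨ bordered-new o′ ⟩
      bordered (u ∷ S) + - (+ 2) * bordered S
        ≡⟨ rearrange (bordered (u ∷ S)) (bordered S) ⟩
      bordered₂ S u u - + 2 * bordered S
        ≡⟨ cong₂ _-_ (joint-minor I o′ u∈ u∈) (rooted-minor I o′) ⟩
      - ([-2]^ m * joint t S u u) - [-2]^ m * rooted t S
        ≡⟨ collect ([-2]^ m) (joint t S u u) (rooted t S) ⟩
      - ([-2]^ m * (joint t S u u + rooted t S))
        ≡⟨ cong (λ a → - ([-2]^ m * a)) (joint-leaf o′) ⟨
      - ([-2]^ m * joint t⁺ S v v) ∎
      where
      rearrange : ∀ a b → a + - (+ 2) * b ≡ a - + 2 * b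
      rearrange = solve-∀

      collect : ∀ q a b → - (q * a) - q * b ≡ - (q * (a + b))
      collect = solve-∀
    joint⁺ {m} {S} {x} {y} o x∈ y∈ | more S′ p =
      zero⁻ ([-2]^ m) (bordered₂-repeatˡ {y = y} q) (joint-repeatˡ t⁺ valid {y = y} (here refl) q)
      where
      q = ↭-trans (↭-prep x p) (to-front x v)
    -- Here `v` is demanded both by `S` and as a floating vertex, so both sides are zero.
    joint⁺ {m} {S} {y = y} o (here refl) y∈ | once S′ p o′ =
      zero⁻ ([-2]^ m) (bordered₂-repeatˡ {y = y} (↭-prep v p))
        (joint-repeatˡ t⁺ valid {y = y} (here refl) (↭-prep v p))
    joint⁺ {m} {S} {x} o (there x∈) (here refl) | once S′ p o′ =
      zero⁻ ([-2]^ m) (bordered₂-repeatʳ {x = x} (↭-prep v p))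
        (joint-repeatʳ t⁺ valid {x = x} (here refl) (↭-prep v p))
    joint⁺ {S = S} {x} {y} o (there x∈) (there y∈) | once {m′} S′ p o′ = begin
      bordered₂ S x y
        ≡⟨ trans (bordered₂-↭ p x y) (bordered₂-new o′ x∈ y∈) ⟩
      bordered₂ (u ∷ S′) x y + - (+ 2) * bordered₂ S′ x y
        ≡⟨ cong₂ (λ a b → a + - (+ 2) * b) (joint-minor I (u∈ ∷ o′) x∈ y∈) (joint-minor I o′ x∈ y∈) ⟩
      - (- (+ 2) * q * joint t (u ∷ S′) x y) + - (+ 2) * - (q * joint t S′ x y)
        ≡⟨ collect q (joint t (u ∷ S′) x y) (joint t S′ x y) ⟩
      - (- (+ 2) * q * (joint t (u ∷ S′) x y + joint t S′ x y))
        ≡⟨ cong (λ a → - (- (+ 2) * q * a)) (trans (joint-↭ t⁺ valid x y p) (joint-new o′ x∈ y∈)) ⟨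
      - (- (+ 2) * q * joint t⁺ S x y) ∎
      where
      q = [-2]^ m′

      collect : ∀ q a b → - (- (+ 2) * q * a) + - (+ 2) * - (q * b) ≡ - (- (+ 2) * q * (a + b))
      collect = solve-∀

    floating⁺ : ∀ {m} {S : Vec A m} {w} → over t⁺ S → w ∈ verts t⁺ →
      + 2 * mixed S w ≡ - ([-2]^ m * floatingAt t⁺ S w)
    floating⁺ {m} {S} {w} o w∈ with occurrences v u t o
    floating⁺ {m} {S} o (there w∈) | none o′ =
      trans (floating-minor I o′ w∈) (cong (λ a → - ([-2]^ m * a)) (sym (floatingAt-old o′ w∈)))
    floating⁺ {m} {S} o (here refl) | none o′ = begin
      + 2 * mixed S v
        ≡⟨ trans (cong (+ 2 *_) (mixed-leaf o′)) (ℤ.*-distribˡ-+ (+ 2) (mixed S u) (bordered S)) ⟩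
      + 2 * mixed S u + + 2 * bordered S
        ≡⟨ cong₂ _+_ (floating-minor I o′ u∈) (rooted-minor I o′) ⟩
      - ([-2]^ m * floatingAt t S u) + [-2]^ m * rooted t S
        ≡⟨ collect ([-2]^ m) (floatingAt t S u) (rooted t S) ⟩
      - ([-2]^ m * (floatingAt t S u - rooted t S))
        ≡⟨ cong (λ a → - ([-2]^ m * a)) (floatingAt-leaf o′) ⟨
      - ([-2]^ m * floatingAt t⁺ S v) ∎
      where
      collect : ∀ q a b → - (q * a) + q * b ≡ - (q * (a - b))
      collect = solve-∀
    floating⁺ {m} {S} {w} o w∈ | more S′ p =
      times-0⁻ (+ 2) ([-2]^ m) (mixed-repeat q) (floatingAt-repeat t⁺ valid (here refl) q)
      where
      q = ↭-trans (↭-prep w p) (to-front w v)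
    floating⁺ {m} {S} o (here refl) | once S′ p o′ =
      times-0⁻ (+ 2) ([-2]^ m) (mixed-repeat (↭-prep v p))
        (floatingAt-repeat t⁺ valid (here refl) (↭-prep v p))
    floating⁺ {S = S} {w} o (there w∈) | once {m′} S′ p o′ = begin
      + 2 * mixed S w
        ≡⟨ cong (+ 2 *_) (trans (mixed-↭ p w) (mixed-new o′ w∈)) ⟩
      + 2 * (mixed (u ∷ S′) w + - bordered₂ S′ u w + - (+ 2) * mixed S′ w)
        ≡⟨ expand (mixed (u ∷ S′) w) (bordered₂ S′ u w) (mixed S′ w) ⟩
      + 2 * mixed (u ∷ S′) w + - (+ 2) * bordered₂ S′ u w + - (+ 2) * (+ 2 * mixed S′ w)
        ≡⟨ cong₂ _+_ (cong₂ (λ a b → a + - (+ 2) * b) (floating-minor I (u∈ ∷ o′) w∈)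
                            -- The minor arises in the order `u`, `w`, but `floatingAt-new` has
                            -- `joint t S′ w u`; the symmetry is taken from the minor, where it is
                            -- immediate.
                            (trans (bordered₂-sym o′ u w) (joint-minor I o′ w∈ u∈)))
                     (cong (- (+ 2) *_) (floating-minor I o′ w∈)) ⟩
      - (- (+ 2) * q * floatingAt t (u ∷ S′) w) + - (+ 2) * - (q * joint t S′ w u)
        + - (+ 2) * - (q * floatingAt t S′ w)
        ≡⟨ collect q (floatingAt t (u ∷ S′) w) (joint t S′ w u) (floatingAt t S′ w) ⟩
      - (- (+ 2) * q * (floatingAt t (u ∷ S′) w + (floatingAt t S′ w + joint t S′ w u)))
        ≡⟨ cong (λ a → - (- (+ 2) * q * a)) (trans (floatingAt-↭ t⁺ valid w p) (floatingAt-new o′ w∈)) ⟨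
      - (- (+ 2) * q * floatingAt t⁺ S w) ∎
      where
      q = [-2]^ m′

      expand : ∀ a b c → + 2 * (a + - b + - (+ 2) * c) ≡ + 2 * a + - (+ 2) * b + - (+ 2) * (+ 2 * c)
      expand = solve-∀

      collect : ∀ q a b c → - (- (+ 2) * q * a) + - (+ 2) * - (q * b) + - (+ 2) * - (q * c) ≡
                            - (- (+ 2) * q * (a + (c + b)))
      collect = solve-∀

    plain⁺ : ∀ {m} {S : Vec A m} → over t⁺ S →
      + 4 * plain S ≡ - ([-2]^ m * ((+ m - + 1) * rooted t⁺ S - floatingΣ t⁺ S))
    plain⁺ {m} {S} o with occurrences v u t o
    ... | none o′ = trans (plain-minor I o′)
      (cong₂ (λ a b → - ([-2]^ m * ((+ m - + 1) * a - b))) (sym (rooted-old o′)) (sym (floatingΣ-old o′)))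
    ... | more S′ p = plain-0 ([-2]^ m) (+ m - + 1) (plain-repeat p)
      (rooted-repeat t⁺ valid (here refl) p) (floatingΣ-repeat t⁺ valid (here refl) p)
    ... | once {m′} S′ p o′ = begin
      + 4 * plain S
        ≡⟨ cong (+ 4 *_) (trans (plain-↭ p) (plain-new o′)) ⟩
      + 4 * (plain (u ∷ S′) + mixed S′ u + (mixed S′ u + bordered S′) + - (+ 2) * plain S′)
        ≡⟨ expand (plain (u ∷ S′)) (mixed S′ u) (bordered S′) (plain S′) ⟩
      + 4 * plain (u ∷ S′) + + 4 * (+ 2 * mixed S′ u) + + 2 * (+ 2 * bordered S′) + - (+ 2) * (+ 4 * plain S′)
        ≡⟨ cong₂ _+_ (cong₂ _+_ (cong₂ (λ a b → a + + 4 * b) (plain-minor I (u∈ ∷ o′)) (floating-minor I o′ u∈))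
                                (cong (+ 2 *_) (rooted-minor I o′)))
                     (cong (- (+ 2) *_) (plain-minor I o′)) ⟩
      - (- (+ 2) * q * ((1ℤ + + m′ - + 1) * rooted t (u ∷ S′) - floatingΣ t (u ∷ S′)))
        + + 4 * - (q * floatingAt t S′ u) + + 2 * (q * rooted t S′)
        + - (+ 2) * - (q * ((+ m′ - + 1) * rooted t S′ - floatingΣ t S′))
        -- The contribution of `bordered S′` raises the coefficient of `rooted t S′` from m′ - 1 to
        -- m′, so that both rooted counts get the same factor. The two mixed minors together give
        -- the term with `floatingAt`.
        ≡⟨ collect q (+ m′) (rooted t (u ∷ S′)) (floatingΣ t (u ∷ S′)) (floatingAt t S′ u)
                   (rooted t S′) (floatingΣ t S′) ⟩
      - (- (+ 2) * q * ((1ℤ + + m′ - + 1) * (rooted t (u ∷ S′) + rooted t S′)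
                        - (floatingΣ t (u ∷ S′) + (floatingΣ t S′ + + 2 * floatingAt t S′ u))))
        ≡⟨ cong₂ (λ a b → - (- (+ 2) * q * ((1ℤ + + m′ - + 1) * a - b)))
                 (trans (rooted-↭ t⁺ valid p) (rooted-new o′))
                 (trans (floatingΣ-↭ t⁺ valid p) (floatingΣ-new o′)) ⟨
      - (- (+ 2) * q * ((1ℤ + + m′ - + 1) * rooted t⁺ S - floatingΣ t⁺ S)) ∎
      where
      q = [-2]^ m′

      expand : ∀ a b c e → + 4 * (a + b + (b + c) + - (+ 2) * e) ≡
                           + 4 * a + + 4 * (+ 2 * b) + + 2 * (+ 2 * c) + - (+ 2) * (+ 4 * e)
      expand = solve-∀

      collect : ∀ q e n₁ Φ₁ γ n₂ Φ₂ →
        - (- (+ 2) * q * ((1ℤ + e - + 1) * n₁ - Φ₁)) + + 4 * - (q * γ) + + 2 * (q * n₂)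
          + - (+ 2) * - (q * ((e - + 1) * n₂ - Φ₂)) ≡
        - (- (+ 2) * q * ((1ℤ + e - + 1) * (n₁ + n₂) - (Φ₁ + (Φ₂ + + 2 * γ))))
      collect = solve-∀

    invariants⁺ : Invariants t⁺
    invariants⁺ = record
      { rooted-minor = rooted⁺ ; joint-minor = joint⁺ ; floating-minor = floating⁺ ; plain-minor = plain⁺ }

  module _ (r : A) where

    private
      t₀ : Tree A 0
      t₀ = seed r

    cov-seed : cov [ r ] (r ∷ []) ≡ 1ℤ
    cov-seed = trans (cov≡𝟙 [ r ] (r ∷ [])) (𝟙-yes (covers? [ r ] (r ∷ [])) (mult-≡ {ms = []} refl ∷ []))

    bordered-root : bordered (r ∷ []) ≡ -1ℤ
    bordered-root = bracket≡det (∞ ∷ just r ∷ []) (∞ ∷ just r ∷ [])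

    rooted₀ : ∀ {m} {S : Vec A m} → over t₀ S → + 2 * bordered S ≡ [-2]^ m * rooted t₀ S
    rooted₀ [] = times-0 (+ 2) 1ℤ (bracket≡det (∞ ∷ []) (∞ ∷ [])) (trans (∑-zero _) (cov-missed (here refl) []))
    rooted₀ (here refl ∷ []) = trans (cong (+ 2 *_) bordered-root)
      (cong (- (+ 2) *_) (sym (trans (∑-zero _) cov-seed)))
    rooted₀ {m} (here refl ∷ here refl ∷ o) =
      times-0 (+ 2) ([-2]^ m) (bordered-repeat ↭-refl) (rooted-repeat t₀ tt (here refl) ↭-refl)

    joint₀ : ∀ {m} {S : Vec A m} {x y} → over t₀ S → x ∈ [ r ] → y ∈ [ r ] →
      bordered₂ S x y ≡ - ([-2]^ m * joint t₀ S x y)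
    joint₀ [] (here refl) (here refl) = trans bordered-root
      (cong (λ a → - (1ℤ * a)) (sym (trans (∑-zero _) (cong₂ _*_ cov-seed (𝟙-yes (r ≟ r) refl)))))
    joint₀ {suc m} (here refl ∷ o) (here refl) (here refl) =
      zero⁻ ([-2]^ (suc m)) (bordered₂-repeatˡ {y = r} (↭-refl {xs = r ∷ r ∷ _}))
        (joint-repeatˡ t₀ tt {x = r} {r} (here refl) ↭-refl)

    floating₀ : ∀ {m} {S : Vec A m} {w} → over t₀ S → w ∈ [ r ] →
      + 2 * mixed S w ≡ - ([-2]^ m * floatingAt t₀ S w)
    floating₀ [] (here refl) = trans (cong (+ 2 *_) (bracket≡det (∞ ∷ []) (just r ∷ [])))
      (cong (λ a → - (1ℤ * a)) (sym (trans (∑-zero _) (cong (_* ψ (+ 0)) cov-seed))))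
    floating₀ {suc m} (here refl ∷ o) (here refl) =
      times-0⁻ (+ 2) ([-2]^ (suc m)) (mixed-repeat ↭-refl) (floatingAt-repeat t₀ tt (here refl) ↭-refl)

    plain₀ : ∀ {m} {S : Vec A m} → over t₀ S →
      + 4 * plain S ≡ - ([-2]^ m * ((+ m - + 1) * rooted t₀ S - floatingΣ t₀ S))
    plain₀ [] = trans (cong (+ 4 *_) (bracket≡det [] []))
      (cong₂ (λ a b → - (1ℤ * ((+ 0 - + 1) * a - b)))
        (sym (trans (∑-zero _) (cov-missed (here refl) [])))
        (sym (trans (∑-zero _) (cong (λ c → c * φ (+ 0) + 0ℤ) cov-seed))))
    plain₀ (here refl ∷ []) = trans (cong (+ 4 *_) plain-root)
      (cong₂ (λ a b → - (- (+ 2) * 1ℤ * (0ℤ * a - b))) {x = rooted t₀ (r ∷ [])} refl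
        (sym (trans (∑-zero _) (cong (λ c → c * φ (+ 0) + 0ℤ) (cov-repeated (here refl) ↭-refl)))))
      where
      plain-root : plain (r ∷ []) ≡ 0ℤ
      plain-root = trans (bracket≡det (just r ∷ []) (just r ∷ [])) (cong (λ x → 1ℤ * x * 1ℤ + 0ℤ) (d-self r))
    plain₀ {suc (suc m)} (here refl ∷ here refl ∷ o) =
      plain-0 ([-2]^ (suc (suc m))) (+ suc (suc m) - + 1) (plain-repeat ↭-refl)
        (rooted-repeat t₀ tt (here refl) ↭-refl) (floatingΣ-repeat t₀ tt (here refl) ↭-refl)

    invariants₀ : Invariants t₀
    invariants₀ = record
      { rooted-minor = rooted₀ ; joint-minor = joint₀ ; floating-minor = floating₀ ; plain-minor = plain₀ }

  invariants : ∀ {k} (t : Tree A k) → Valid t → Metric t → Invariants t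
  invariants (seed r)       _     _          = invariants₀ r
  invariants (sprout v u t) valid (leaf , μ) =
    Grow.invariants⁺ v u t valid leaf (invariants t (proj₂ (proj₂ valid)) μ)

-- Paths and leaf orders of a tree graph

_∈?_ : ∀ {n} (x : Fin n) xs → Dec (x ∈ xs)
x ∈? xs = Any.any? (x Fin.≟_) xs

module _ {n} (G : Graph n) where

  open Graph G

  adj-sym : ∀ {F i j} → Adj G F i j → Adj G F j i
  adj-sym (e , e∈F , ends≡) = e , e∈F , swap ends≡

  reversal : ∀ {F i j} → Walk G F i j → Walk G F j i
  reversal ε       = ε
  reversal (a ◅ w) = reversal w ◅◅ adj-sym a ◅ ε

  start∈ : ∀ {F i j} (w : Walk G F i j) → i ∈ vertices G w
  start∈ ε       = here refl
  start∈ (_ ◅ _) = here refl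

  end∈ : ∀ {F i j} (w : Walk G F i j) → j ∈ vertices G w
  end∈ ε       = here refl
  end∈ (_ ◅ w) = there (end∈ w)

  ∈-◅◅ : ∀ {F i j k x} (w : Walk G F i j) (w′ : Walk G F j k) →
    x ∈ vertices G (w ◅◅ w′) → x ∈ vertices G w ⊎ x ∈ vertices G w′
  ∈-◅◅ ε       w′ x∈          = inj₂ x∈
  ∈-◅◅ (_ ◅ w) w′ (here refl) = inj₁ (here refl)
  ∈-◅◅ (_ ◅ w) w′ (there x∈) with ∈-◅◅ w w′ x∈
  ... | inj₁ x∈w  = inj₁ (there x∈w)
  ... | inj₂ x∈w′ = inj₂ x∈w′

  ∈-reversal : ∀ {F i j x} (w : Walk G F i j) → x ∈ vertices G (reversal w) → x ∈ vertices G w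
  ∈-reversal ε       x∈ = x∈
  ∈-reversal (a ◅ w) x∈ with ∈-◅◅ (reversal w) (adj-sym a ◅ ε) x∈
  ... | inj₁ x∈w                 = there (∈-reversal w x∈w)
  ... | inj₂ (here refl)         = there (start∈ w)
  ... | inj₂ (there (here refl)) = here refl

  edgeCount-◅◅ : ∀ {F i j k} (w : Walk G F i j) (w′ : Walk G F j k) →
    edgeCount G (w ◅◅ w′) ≡ edgeCount G w ℕ.+ edgeCount G w′
  edgeCount-◅◅ ε       w′ = refl
  edgeCount-◅◅ (_ ◅ w) w′ = cong suc (edgeCount-◅◅ w w′)

  edgeCount-reversal : ∀ {F i j} (w : Walk G F i j) → edgeCount G (reversal w) ≡ edgeCount G w
  edgeCount-reversal ε       = refl
  edgeCount-reversal (a ◅ w) = trans (edgeCount-◅◅ (reversal w) (adj-sym a ◅ ε))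
    (trans (ℕ.+-comm _ 1) (cong suc (edgeCount-reversal w)))

  record Shortcut {F i j} (xs : List (Fin n)) (l : ℕ) : Set where
    constructor shortcut
    field
      path   : Path G F i j
      within : ∀ {x} → x ∈ vertices G (proj₁ path) → x ∈ xs
      bound  : edgeCount G (proj₁ path) ≤ l

  suffix : ∀ {F i j k} (w : Walk G F k j) → Unique (vertices G w) → i ∈ vertices G w →
    Shortcut {F} {i} {j} (vertices G w) (edgeCount G w)
  suffix ε       u       (here refl) = shortcut (ε , u) (λ x∈ → x∈) ℕ.≤-refl
  suffix (a ◅ w) u       (here refl) = shortcut (a ◅ w , u) (λ x∈ → x∈) ℕ.≤-refl
  suffix (a ◅ w) (_ ∷ u) (there i∈) with suffix w u i∈
  ... | shortcut p within bound = shortcut p (there ∘ within) (ℕ.m≤n⇒m≤1+n bound)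

  -- Loop erasure. The field `within` serves to keep the path away from a given vertex, and `bound`
  -- to compare lengths.
  extract : ∀ {F i j} (w : Walk G F i j) → Shortcut {F} {i} {j} (vertices G w) (edgeCount G w)
  extract ε = shortcut (ε , [] ∷ []) (λ x∈ → x∈) z≤n
  extract {i = i} (a ◅ w) with extract w
  ... | shortcut (p , u) within bound with i ∈? vertices G p
  ...   | no i∉  = shortcut (a ◅ p , ¬Any⇒All¬ _ i∉ ∷ u)
                     (λ { (here eq) → here eq ; (there x∈) → there (within x∈) }) (s≤s bound)
  ...   | yes i∈ with suffix p u i∈
  ...     | shortcut q within′ bound′ =
    shortcut q (there ∘ within ∘ within′) (ℕ.≤-trans bound′ (ℕ.m≤n⇒m≤1+n bound))

  -- If the first steps lead to different vertices `x` and `y`, then `p` followed by `q` backwards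
  -- goes from `x` to `y` without meeting `i`. After loop erasure it closes up through `i` to a
  -- cycle.
  path-length : ∀ {F i j} → Acyclic G F → (p q : Walk G F i j) →
    Unique (vertices G p) → Unique (vertices G q) → edgeCount G p ≡ edgeCount G q
  path-length acyclic ε ε _ _ = refl
  path-length acyclic ε (_ ◅ q) _ (i∉ ∷ _) = ⊥-elim (All.lookup i∉ (end∈ q) refl)
  path-length acyclic (_ ◅ p) ε (i∉ ∷ _) _ = ⊥-elim (All.lookup i∉ (end∈ p) refl)
  path-length {i = i} acyclic (_◅_ {j = x} a p) (_◅_ {j = y} b q) (i∉p ∷ up) (i∉q ∷ uq) with x Fin.≟ y
  ... | yes refl = cong suc (path-length acyclic p q up uq)
  ... | no x≢y with extract (p ◅◅ reversal q)
  ...   | shortcut (ε , _) _ _           = ⊥-elim (x≢y refl)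
  ...   | shortcut (c ◅ r , u) within _ =
    -- The erased path from `x` to `y` has at least one edge because the two differ; with the edge
    -- from `i` to `x` in front it has the two edges that `Cycle` requires.
    ⊥-elim (acyclic (y , i , adj-sym b , (a ◅ c ◅ r , All.tabulate avoids ∷ u) , s≤s (s≤s z≤n)))
    where
    avoids : ∀ {z} → z ∈ vertices G (c ◅ r) → i ≢ z
    avoids z∈ with ∈-◅◅ p (reversal q) (within z∈)
    ... | inj₁ z∈p = All.lookup i∉p z∈p
    ... | inj₂ z∈q = All.lookup i∉q (∈-reversal q z∈q)

module Distance {n} {T : Graph n} (tree : IsTree T) where

  open IsTree tree
  open Graph T

  δ⟨_,_⟩ : Fin n → Fin n → ℕ
  δ⟨ i , j ⟩ = distance tree i j

  distance-path : ∀ {i j} (p : Path T ⊤ i j) → edgeCount T (proj₁ p) ≡ δ⟨ i , j ⟩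
  distance-path {i} {j} (p , u) = path-length T acyclic p (proj₁ (path i j)) u (proj₂ (path i j))

  distance-self : ∀ i → δ⟨ i , i ⟩ ≡ 0
  distance-self i = sym (distance-path (ε , [] ∷ []))

  -- Erasing loops in the reversed path bounds each distance by the other.
  distance-sym : ∀ i j → δ⟨ i , j ⟩ ≡ δ⟨ j , i ⟩
  distance-sym i j = ℕ.≤-antisym (reversed i j) (reversed j i)
    where
    reversed : ∀ i j → δ⟨ i , j ⟩ ≤ δ⟨ j , i ⟩
    reversed i j with extract T (reversal T (proj₁ (path j i)))
    ... | shortcut p _ bound = ℕ.≤-trans (ℕ.≤-reflexive (sym (distance-path p)))
      (ℕ.≤-trans bound (ℕ.≤-reflexive (edgeCount-reversal T (proj₁ (path j i)))))

  distance-0 : ∀ {i j} → δ⟨ i , j ⟩ ≡ 0 → i ≡ j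
  distance-0 {i} {j} eq with proj₁ (path i j) | eq
  ... | ε     | _  = refl
  ... | _ ◅ _ | ()

  loopless : ∀ {F i} → ¬ Adj T F i i
  loopless (e , _ , inj₁ eq) = Fin.<-irrefl (trans (cong proj₁ eq) (sym (cong proj₂ eq))) (ordered e)
  loopless (e , _ , inj₂ eq) = Fin.<-irrefl (trans (cong proj₁ eq) (sym (cong proj₂ eq))) (ordered e)

  distance-adj : ∀ {i j} → Adj T ⊤ i j → δ⟨ i , j ⟩ ≡ 1
  distance-adj {i} {j} a = sym (distance-path (a ◅ ε , ((λ { refl → loopless a }) ∷ []) ∷ [] ∷ []))

  open Forests (Fin._≟_ {n})

  Ends : Fin #E → Fin n → Fin n → Set
  Ends e i j = ends e ≡ (i , j) ⊎ ends e ≡ (j , i)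

  Labelled : ∀ {k} → Tree (Fin n) k → Vec (Fin #E) k → Set
  Labelled (seed r)       []       = 𝟏
  Labelled (sprout v u t) (e ∷ es) = Ends e v u × Labelled t es

  ends∈ : ∀ {k} (t : Tree (Fin n) k) es {e i j} → Valid t → Labelled t es → e ∈ᵥ es → Ends e i j →
    i ∈ verts t × j ∈ verts t
  ends∈ (sprout v u t) (e ∷ es) (_ , u∈ , _) (l , _) (AnyVec.here refl) ends≡ = oriented l ends≡
    where
    oriented : ∀ {p i j} → p ≡ (v , u) ⊎ p ≡ (u , v) → p ≡ (i , j) ⊎ p ≡ (j , i) →
      i ∈ v ∷ verts t × j ∈ v ∷ verts t
    oriented (inj₁ refl) (inj₁ refl) = here refl , there u∈
    oriented (inj₁ refl) (inj₂ refl) = there u∈ , here refl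
    oriented (inj₂ refl) (inj₁ refl) = there u∈ , here refl
    oriented (inj₂ refl) (inj₂ refl) = here refl , there u∈
  ends∈ (sprout v u t) (_ ∷ es) (_ , _ , V) (_ , L) (AnyVec.there e∈) ends≡ with ends∈ t es V L e∈ ends≡
  ... | i∈ , j∈ = there i∈ , there j∈

  edge∉ : ∀ {k} v u (t : Tree (Fin n) k) e es → Valid (sprout v u t) → Labelled (sprout v u t) (e ∷ es) → ¬ e ∈ᵥ es
  edge∉ v u t e es (v∉ , _ , V) (l , L) e∈ = v∉ (proj₁ (ends∈ t es V L e∈ l))

  edge : ∀ {e v u} → Ends e v u → Adj T ⊤ v u
  edge {e} l = e , Subset.∈⊤ , l

  connection : ∀ {k} (t : Tree (Fin n) k) es {x y} → Valid t → Labelled t es → x ∈ verts t → y ∈ verts t →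
    Σ (Walk T ⊤ x y) λ w → ∀ {z} → z ∈ vertices T w → z ∈ verts t
  connection (seed r) [] _ _ (here refl) (here refl) = ε , λ z∈ → z∈
  connection (sprout v u t) (e ∷ es) _ (l , L) (here refl) (here refl) = ε , λ { (here refl) → here refl }
  connection (sprout v u t) (e ∷ es) (_ , u∈ , V) (l , L) (here refl) (there y∈)
    with connection t es V L u∈ y∈
  ... | w , within = edge l ◅ w , λ { (here refl) → here refl ; (there z∈) → there (within z∈) }
  connection (sprout v u t) (e ∷ es) (_ , u∈ , V) (l , L) (there x∈) (here refl)
    with connection t es V L x∈ u∈
  ... | w , within = w ◅◅ last ◅ ε , within⁺
    where
    last : Adj T ⊤ u v
    last = adj-sym T (edge l)

    within⁺ : ∀ {z} → z ∈ vertices T (w ◅◅ last ◅ ε) → z ∈ v ∷ verts t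
    within⁺ z∈ with ∈-◅◅ T w (last ◅ ε) z∈
    ... | inj₁ z∈w                 = there (within z∈w)
    ... | inj₂ (here refl)         = there u∈
    ... | inj₂ (there (here refl)) = here refl
  connection (sprout v u t) (e ∷ es) (_ , u∈ , V) (l , L) (there x∈) (there y∈)
    with connection t es V L x∈ y∈
  ... | w , within = w , there ∘ within

  D : Matrix ℤ n
  D = distanceMatrix tree

  D-self : ∀ x → D x x ≡ 0ℤ
  D-self x = cong +_ (distance-self x)

  D-sym : ∀ x y → D x y ≡ D y x
  D-sym x y = cong +_ (distance-sym x y)

  open Minors (Fin._≟_ {n}) D D-self D-sym using (Metric)

  -- Some path from `u` to `y` stays inside `t`, so it misses the fresh vertex `v` and remains a
  -- path with `v` put in front.
  leaf-distance : ∀ {k} v u (t : Tree (Fin n) k) e es → Valid (sprout v u t) → Labelled (sprout v u t) (e ∷ es) →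
    ∀ {y} → y ∈ verts t → δ⟨ v , y ⟩ ≡ suc δ⟨ u , y ⟩
  leaf-distance v u t e es (v∉ , u∈ , V) (l , L) y∈ with connection t es V L u∈ y∈
  ... | w , within with extract T w
  ...   | shortcut (p , up) within′ _ =
    trans (sym (distance-path (edge l ◅ p , All.tabulate (λ { z∈ refl → v∉ (within (within′ z∈)) }) ∷ up)))
          (cong suc (distance-path (p , up)))

  metric : ∀ {k} (t : Tree (Fin n) k) es → Valid t → Labelled t es → Metric t
  metric (seed r)       []       _ _ = tt
  metric (sprout v u t) (e ∷ es) valid labelled =
    (λ {y} y∈ → trans (cong +_ (leaf-distance v u t e es valid labelled y∈)) (ℤ.+-comm 1ℤ (D u y))) ,
    metric t es (proj₂ (proj₂ valid)) (proj₂ labelled)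

  directed : ∀ e {i j} → ends e ≡ (i , j) → i Fin.< j
  directed e eq = subst (λ p → proj₁ p Fin.< proj₂ p) eq (ordered e)

  same-edge : ∀ {e e′ i j} → Ends e i j → Ends e′ i j → e ≡ e′
  same-edge {e} {e′} (inj₁ p) (inj₁ q) = injective (trans p (sym q))
  same-edge {e} {e′} (inj₂ p) (inj₂ q) = injective (trans p (sym q))
  same-edge {e} {e′} (inj₁ p) (inj₂ q) = ⊥-elim (Fin.<-asym (directed e p) (directed e′ q))
  same-edge {e} {e′} (inj₂ p) (inj₁ q) = ⊥-elim (Fin.<-asym (directed e p) (directed e′ q))

  -- There are no chords: an edge from the leaf `v` to an old vertex `j` has length 1, so
  -- `leaf-distance` puts `j` at distance 0 from `u`. Hence `j` is `u`, and the edge is the labelled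
  -- one since the graph is simple.
  edges-complete : ∀ {k} (t : Tree (Fin n) k) es → Valid t → Labelled t es →
    ∀ {e i j} → i ∈ verts t → j ∈ verts t → Ends e i j → e ∈ᵥ es
  edges-complete (seed r) [] _ _ (here refl) (here refl) l = ⊥-elim (loopless (edge l))
  edges-complete (sprout v u t) (e′ ∷ es) valid (l′ , L) (here refl) (here refl) l = ⊥-elim (loopless (edge l))
  edges-complete (sprout v u t) (e′ ∷ es) valid (l′ , L) (there i∈) (there j∈) l =
    AnyVec.there (edges-complete t es (proj₂ (proj₂ valid)) L i∈ j∈ l)
  edges-complete (sprout v u t) (e′ ∷ es) valid (l′ , L) (here refl) (there j∈) l =
    AnyVec.here (same-edge l (subst (Ends e′ v) (distance-0 (ℕ.suc-injective
      (trans (sym (leaf-distance v u t e′ es valid (l′ , L) j∈)) (distance-adj (edge l))))) l′))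
  edges-complete (sprout v u t) (e′ ∷ es) valid (l′ , L) (there i∈) (here refl) l =
    edges-complete (sprout v u t) (e′ ∷ es) valid (l′ , L) (here refl) (there i∈) (swap l)

  record Growth : Set where
    constructor growth
    field
      {size}   : ℕ
      tree⁺    : Tree (Fin n) size
      labels   : Vec (Fin #E) size
      valid    : Valid tree⁺
      labelled : Labelled tree⁺ labels

  open Growth public

  Reaching : Growth → List (Fin n) → Set
  Reaching g xs = Σ Growth λ g′ → (∀ {z} → z ∈ verts (tree⁺ g) → z ∈ verts (tree⁺ g′)) ×
                                   (∀ {z} → z ∈ xs → z ∈ verts (tree⁺ g′))

  -- A step of the walk either stays among the vertices already present or leads to a fresh one,
  -- which can be hung as a leaf at its predecessor.
  reach : ∀ g {i j} → Walk T ⊤ i j → i ∈ verts (tree⁺ g) → Reaching g [ j ]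
  reach g ε i∈ = g , (λ z∈ → z∈) , λ { (here refl) → i∈ }
  reach g {i} (_◅_ {j = k} (e , _ , l) w) i∈ with k ∈? verts (tree⁺ g)
  ... | yes k∈ = reach g w k∈
  ... | no k∉ with reach (growth (sprout k i (tree⁺ g)) (e ∷ labels g) (k∉ , i∈ , valid g) (swap l , labelled g))
                          w (here refl)
  ...   | g′ , grows , reaches = g′ , grows ∘ there , reaches

  reach-all : ∀ g {i} → i ∈ verts (tree⁺ g) → ∀ xs → Reaching g xs
  reach-all g i∈ [] = g , (λ z∈ → z∈) , λ ()
  reach-all g {i} i∈ (x ∷ xs) with reach g (proj₁ (path i x)) i∈
  ... | g′ , grows , reaches with reach-all g′ (grows i∈) xs
  ...   | g″ , grows′ , reaches′ = g″ , grows′ ∘ grows ,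
    λ { (here refl) → grows′ (reaches (here refl)) ; (there z∈) → reaches′ z∈ }

  spanning-growth : Fin n → Σ Growth λ g → ∀ z → z ∈ verts (tree⁺ g)
  spanning-growth r with reach-all (growth (seed r) [] tt tt) (here refl) (allFin n)
  ... | g , _ , reaches = g , λ z → reaches (∈-allFin z)

-- Sums over subsets

module _ {A : Set} where

  unique-↭ : ∀ {xs ys : List A} → Unique xs → Unique ys →
    (∀ {z} → z ∈ xs → z ∈ ys) → (∀ {z} → z ∈ ys → z ∈ xs) → xs ↭ˡ ys
  unique-↭ u u′ f g = ∼bag⇒↭ (unique∧set⇒bag u u′ (mk⇔ f g))

  sumOver-↭ : ∀ {xs ys : List A} (f : A → ℤ) → xs ↭ˡ ys → sumOver xs f ≡ sumOver ys f
  sumOver-↭ f Perm.refl          = refl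
  sumOver-↭ f (Perm.prep x p)    = cong (_+_ (f x)) (sumOver-↭ f p)
  sumOver-↭ f (Perm.swap x y p) =
    trans (cong (λ s → f x + (f y + s)) (sumOver-↭ f p)) (exchange (f x) (f y) _)
    where
    exchange : ∀ a b c → a + (b + c) ≡ b + (a + c)
    exchange = solve-∀
  sumOver-↭ f (Perm.trans p q)   = trans (sumOver-↭ f p) (sumOver-↭ f q)

  sumOver-map : ∀ {B : Set} (g : B → A) (f : A → ℤ) xs → sumOver (List.map g xs) f ≡ sumOver xs (f ∘ g)
  sumOver-map g f []       = refl
  sumOver-map g f (x ∷ xs) = cong (_+_ (f (g x))) (sumOver-map g f xs)

  sumOver-++ : ∀ (f : A → ℤ) xs ys → sumOver (xs ++ ys) f ≡ sumOver xs f + sumOver ys f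
  sumOver-++ f []       ys = sym (ℤ.+-identityˡ _)
  sumOver-++ f (x ∷ xs) ys = trans (cong (_+_ (f x)) (sumOver-++ f xs ys)) (sym (ℤ.+-assoc (f x) _ _))

  module _ {P : A → Set} (P? : U.Decidable P) where

    sumOver-filter : ∀ f xs → sumOver (filter P? xs) f ≡ sumOver xs λ x → 𝟙 (P? x) * f x
    sumOver-filter f [] = refl
    sumOver-filter f (x ∷ xs) with P? x
    ... | yes _ = cong₂ _+_ (sym (ℤ.*-identityˡ (f x))) (sumOver-filter f xs)
    ... | no _  = trans (sumOver-filter f xs) (sym (ℤ.+-identityˡ _))

    length-filter : ∀ xs → + length (filter P? xs) ≡ sumOver xs λ x → 𝟙 (P? x)
    length-filter [] = refl
    length-filter (x ∷ xs) with P? x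
    ... | yes _ = cong (_+_ 1ℤ) (length-filter xs)
    ... | no _  = trans (length-filter xs) (sym (ℤ.+-identityˡ _))

subsets-complete : ∀ {k} (F : Subset k) → F ∈ subsets k
subsets-complete []            = here refl
subsets-complete (outside ∷ F) = ∈-++⁺ˡ (∈-map⁺ (outside ∷_) (subsets-complete F))
subsets-complete (inside  ∷ F) = ∈-++⁺ʳ (List.map (outside ∷_) (subsets _)) (∈-map⁺ (inside ∷_) (subsets-complete F))

subsets-unique : ∀ k → Unique (subsets k)
subsets-unique zero    = [] ∷ []
subsets-unique (suc k) = Unique.++⁺ (Unique.map⁺ Vec.∷-injectiveʳ (subsets-unique k))
                                    (Unique.map⁺ Vec.∷-injectiveʳ (subsets-unique k)) disjoint
  where
  disjoint : ∀ {F} → ¬ (F ∈ List.map (outside ∷_) (subsets k) × F ∈ List.map (inside ∷_) (subsets k))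
  disjoint (F∈ , F∈′) with ∈-map⁻ (outside ∷_) F∈ | ∈-map⁻ (inside ∷_) F∈′
  ... | _ , _ , refl | _ , _ , ()

sumOver-subsets : ∀ {k} (f : Subset k → ℤ) → sumOver (subsets k) f ≡ ∑ f
sumOver-subsets {zero}  f = trans (ℤ.+-identityʳ (f [])) (sym (∑-zero f))
sumOver-subsets {suc k} f = begin
  sumOver (List.map (outside ∷_) (subsets k) ++ List.map (inside ∷_) (subsets k)) f
    ≡⟨ sumOver-++ f (List.map (outside ∷_) (subsets k)) (List.map (inside ∷_) (subsets k)) ⟩
  sumOver (List.map (outside ∷_) (subsets k)) f + sumOver (List.map (inside ∷_) (subsets k)) f
    ≡⟨ cong₂ _+_ (trans (sumOver-map (outside ∷_) f (subsets k)) (sumOver-subsets (f ∘ (outside ∷_))))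
                 (trans (sumOver-map (inside ∷_) f (subsets k)) (sumOver-subsets (f ∘ (inside ∷_)))) ⟩
  ∑ (f ∘ (false ∷_)) + ∑ (f ∘ (true ∷_))
    ≡⟨ ℤ.+-comm (∑ (f ∘ (false ∷_))) _ ⟩
  ∑ (f ∘ (true ∷_)) + ∑ (f ∘ (false ∷_))
    ≡⟨ ∑-suc f ⟨
  ∑ f ∎
  where open ≡-Reasoning

restrict : ∀ {l k} → Vec (Fin l) k → Subset l → Vec Bool k
restrict es F = Vec.map (lookup F) es

restrict-lookup : ∀ {l k} (es : Vec (Fin l) k) F F′ → restrict es F ≡ restrict es F′ →
  ∀ {e} → e ∈ᵥ es → lookup F e ≡ lookup F′ e
restrict-lookup (e ∷ es) F F′ eq (AnyVec.here refl) = Vec.∷-injectiveˡ eq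
restrict-lookup (e ∷ es) F F′ eq (AnyVec.there e∈)  = restrict-lookup es F F′ (Vec.∷-injectiveʳ eq) e∈

restrict-surjective : ∀ {l k} (es : Vec (Fin l) k) → UniqueVec es → ∀ bs → Σ (Subset l) λ F → restrict es F ≡ bs
restrict-surjective []       _                     []       = Subset.⊥ , refl
restrict-surjective (e ∷ es) (e∉ AllPairsVec.∷ u) (b ∷ bs) with restrict-surjective es u bs
... | F , eq = F [ e ]≔ b , cong₂ _∷_ (Vec.lookup∘update e F b) (trans (unchanged e∉) eq)
  where
  unchanged : ∀ {j} {es : Vec _ j} → AllVec (e ≢_) es → restrict es (F [ e ]≔ b) ≡ restrict es F
  unchanged []        = refl
  unchanged (e≢ ∷ e∉) = cong₂ _∷_ (Vec.lookup∘update′ (e≢ ∘ sym) F b) (unchanged e∉)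

-- `restrict es` is a bijection: it is injective because every edge is listed, and onto because no
-- edge is listed twice. This carries sums over edge sets to sums over bit vectors in growth order.
∑-restrict : ∀ {l k} (es : Vec (Fin l) k) → UniqueVec es → (∀ e → e ∈ᵥ es) → (g : Vec Bool k → ℤ) →
  sumOver (subsets l) (g ∘ restrict es) ≡ ∑ g
∑-restrict {l} {k} es u complete g = begin
  sumOver (subsets l) (g ∘ restrict es)
    ≡⟨ sumOver-map (restrict es) g (subsets l) ⟨
  sumOver (List.map (restrict es) (subsets l)) g
    ≡⟨ sumOver-↭ g (unique-↭ (Unique.map⁺ injective (subsets-unique l)) (subsets-unique k)
                             (λ _ → subsets-complete _) onto) ⟩
  sumOver (subsets k) g
    ≡⟨ sumOver-subsets g ⟩
  ∑ g ∎
  where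
  injective : ∀ {F F′} → restrict es F ≡ restrict es F′ → F ≡ F′
  injective {F} {F′} eq = trans (sym (Vec.tabulate∘lookup F))
    (trans (Vec.tabulate-cong λ e → restrict-lookup es F F′ eq (complete e)) (Vec.tabulate∘lookup F′))

  onto : ∀ {bs} → bs ∈ subsets k → bs ∈ List.map (restrict es) (subsets l)
  onto {bs} _ with restrict-surjective es u bs
  ... | F , refl = ∈-map⁺ (restrict es) (subsets-complete F)

-- Boundaries and components of a spanning forest

-- A count together with its evidence, which can be built along the layers of a tree without
-- deciding `P`; `counts-filter` passes the number on to a decidable filter.
data Counts {A : Set} (P : A → Set) : List A → ℕ → Set where
  []  : Counts P [] 0
  hit  : ∀ {x xs c} → P x → Counts P xs c → Counts P (x ∷ xs) (suc c)
  miss : ∀ {x xs c} → ¬ P x → Counts P xs c → Counts P (x ∷ xs) c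

module _ {A : Set} where

  counts-filter : ∀ {P : A → Set} (P? : U.Decidable P) {xs c} → Counts P xs c → length (filter P? xs) ≡ c
  counts-filter P? [] = refl
  counts-filter P? (hit {x = x} p c) with P? x
  ... | yes _ = cong suc (counts-filter P? c)
  ... | no ¬p = ⊥-elim (¬p p)
  counts-filter P? (miss {x = x} ¬p c) with P? x
  ... | yes p = ⊥-elim (¬p p)
  ... | no _  = counts-filter P? c

  counts-resp : ∀ {P Q : A → Set} {xs c} → (∀ {x} → x ∈ xs → P x → Q x) → (∀ {x} → x ∈ xs → Q x → P x) →
    Counts P xs c → Counts Q xs c
  counts-resp f g []         = []
  counts-resp f g (hit p c)   = hit (f (here refl) p) (counts-resp (f ∘ there) (g ∘ there) c)
  counts-resp f g (miss ¬p c) = miss (¬p ∘ g (here refl)) (counts-resp (f ∘ there) (g ∘ there) c)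

  counts-none : ∀ {P : A → Set} xs → (∀ {x} → x ∈ xs → ¬ P x) → Counts P xs 0
  counts-none []       ¬p = []
  counts-none (x ∷ xs) ¬p = miss (¬p (here refl)) (counts-none xs (¬p ∘ there))

  counts-single : ∀ {x xs} → Unique xs → x ∈ xs → Counts (_≡ x) xs 1
  counts-single (x∉ ∷ u) (here refl) = hit refl (counts-none _ λ y∈ eq → All.lookup x∉ y∈ (sym eq))
  counts-single (y∉ ∷ u) (there x∈)  = miss (All.lookup y∉ x∈) (counts-single u x∈)

module Boundaries {A : Set} (_≟_ : DecidableEquality A) where
  open Forests _≟_

  verts-unique : ∀ {k} (t : Tree A k) → Valid t → Unique (verts t)
  verts-unique (seed r)       _            = [] ∷ []
  verts-unique (sprout v u t) (v∉ , _ , V) = All.tabulate (λ { x∈ refl → v∉ x∈ }) ∷ verts-unique t V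

  Near : ∀ {k} → Tree A k → A → A → Set
  Near (seed r)       w y = ⊥
  Near (sprout v u t) w y = (w ≡ v × y ≡ u) ⊎ (w ≡ u × y ≡ v) ⊎ Near t w y

  near∈ : ∀ {k} (t : Tree A k) {w y} → Valid t → Near t w y → w ∈ verts t × y ∈ verts t
  near∈ (sprout v u t) (_ , u∈ , V) (inj₁ (refl , refl))        = here refl , there u∈
  near∈ (sprout v u t) (_ , u∈ , V) (inj₂ (inj₁ (refl , refl))) = there u∈ , here refl
  near∈ (sprout v u t) (_ , u∈ , V) (inj₂ (inj₂ near)) with near∈ t V near
  ... | w∈ , y∈ = there w∈ , there y∈

  Border : ∀ {k} → Tree A k → Vec Bool k → A → A → Set
  Border t F a w = rep t F w ≢ a × ∃[ y ] rep t F y ≡ a × Near t w y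

  -- A kept edge has both ends in one component, so it creates no border. A cut edge makes `u` the
  -- only border vertex of `v`, and adds `v` to the border of the component of `u` and of no other.
  counts-border : ∀ {k} (t : Tree A k) F {a} → Valid t → a ∈ tops t F →
    Counts (Border t F a) (verts t) (cutDegree t F a)
  counts-border (seed r) [] _ _ = miss (λ { (_ , _ , _ , ()) }) []
  counts-border (sprout v u t) (true ∷ F) {a} (v∉ , u∈ , V) a∈ =
    miss leaf (counts-resp to from (counts-border t F V a∈))
    where
    old : ∀ {x} → x ∈ verts t → rep (sprout v u t) (true ∷ F) x ≡ rep t F x
    old x∈ = rep-old t true F λ { refl → v∉ x∈ }

    leaf : ¬ Border (sprout v u t) (true ∷ F) a v
    leaf (≢a , y , ≡a , inj₁ (_ , refl)) = ≢a (trans (rep-joined t F) (trans (sym (old u∈)) ≡a))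
    leaf (≢a , y , ≡a , inj₂ (inj₁ (refl , refl))) = v∉ u∈
    leaf (≢a , y , ≡a , inj₂ (inj₂ near)) = v∉ (proj₁ (near∈ t V near))

    to : ∀ {w} → w ∈ verts t → Border t F a w → Border (sprout v u t) (true ∷ F) a w
    to w∈ (≢a , y , ≡a , near) =
      ≢a ∘ trans (sym (old w∈)) , y , trans (old (proj₂ (near∈ t V near))) ≡a , inj₂ (inj₂ near)

    from : ∀ {w} → w ∈ verts t → Border (sprout v u t) (true ∷ F) a w → Border t F a w
    from w∈ (≢a , y , ≡a , inj₁ (refl , _)) = ⊥-elim (v∉ w∈)
    from w∈ (≢a , y , ≡a , inj₂ (inj₁ (refl , refl))) =
      ⊥-elim (≢a (trans (old w∈) (trans (sym (rep-joined t F)) ≡a)))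
    from w∈ (≢a , y , ≡a , inj₂ (inj₂ near)) =
      ≢a ∘ trans (old w∈) , y , trans (sym (old (proj₂ (near∈ t V near)))) ≡a , near
  counts-border (sprout v u t) (false ∷ F) {a} (v∉ , u∈ , V) (here refl) =
    subst (Counts _ _) (sym (cutDegree-leaf {u = u} t F))
      (miss (λ { (≢a , _) → ≢a (rep-cut {u = u} t F) })
          (counts-resp to from (counts-single (verts-unique t V) u∈)))
    where
    old : ∀ {x} → x ∈ verts t → rep (sprout v u t) (false ∷ F) x ≢ v
    old x∈ eq = v∉ (tops⊆verts t F (subst (_∈ tops t F)
      (trans (sym (rep-old {u = u} t false F λ { refl → v∉ x∈ })) eq) (rep∈tops t F V x∈)))

    to : ∀ {w} → w ∈ verts t → w ≡ u → Border (sprout v u t) (false ∷ F) v w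
    to w∈ refl = old w∈ , v , rep-cut {u = u} t F , inj₂ (inj₁ (refl , refl))

    from : ∀ {w} → w ∈ verts t → Border (sprout v u t) (false ∷ F) v w → w ≡ u
    from w∈ (_ , y , ≡a , inj₁ (refl , _))        = ⊥-elim (v∉ w∈)
    from w∈ (_ , y , ≡a , inj₂ (inj₁ (refl , _))) = refl
    from w∈ (_ , y , ≡a , inj₂ (inj₂ near))       = ⊥-elim (old (proj₂ (near∈ t V near)) ≡a)
  counts-border (sprout v u t) (false ∷ F) {a} (v∉ , u∈ , V) (there a∈) = leaf (a ≟ rep t F u)
    where
    t⁺ = sprout v u t

    a≢v : a ≢ v
    a≢v refl = v∉ (tops⊆verts t F a∈)

    old : ∀ {x} → x ∈ verts t → rep t⁺ (false ∷ F) x ≡ rep t F x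
    old x∈ = rep-old {u = u} t false F λ { refl → v∉ x∈ }

    rep-v : rep t⁺ (false ∷ F) v ≡ v
    rep-v = rep-cut {u = u} t F

    to : ∀ {w} → w ∈ verts t → Border t F a w → Border t⁺ (false ∷ F) a w
    to w∈ (≢a , y , ≡a , near) =
      ≢a ∘ trans (sym (old w∈)) , y , trans (old (proj₂ (near∈ t V near))) ≡a , inj₂ (inj₂ near)

    from : ∀ {w} → w ∈ verts t → Border t⁺ (false ∷ F) a w → Border t F a w
    from w∈ (≢a , y , ≡a , inj₁ (refl , _)) = ⊥-elim (v∉ w∈)
    from w∈ (≢a , y , ≡a , inj₂ (inj₁ (refl , refl))) = ⊥-elim (a≢v (trans (sym ≡a) rep-v))
    from w∈ (≢a , y , ≡a , inj₂ (inj₂ near)) =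
      ≢a ∘ trans (old w∈) , y , trans (sym (old (proj₂ (near∈ t V near)))) ≡a , near

    rest : Counts (Border t⁺ (false ∷ F) a) (verts t) (cutDegree t F a)
    rest = counts-resp to from (counts-border t F V a∈)

    leaf : Dec (a ≡ rep t F u) → Counts (Border t⁺ (false ∷ F) a) (v ∷ verts t) (cutDegree t⁺ (false ∷ F) a)
    leaf (yes eq) = subst (Counts _ _) (sym degree≡)
      (hit ((λ v≡a → a≢v (trans (sym v≡a) rep-v)) , u , trans (old u∈) (sym eq) , inj₁ (refl , refl)) rest)
      where
      degree≡ : cutDegree t⁺ (false ∷ F) a ≡ suc (cutDegree t F a)
      degree≡ rewrite dec-false (a ≟ v) a≢v | dec-true (a ≟ rep t F u) eq = refl
    leaf (no neq) = subst (Counts _ _) (sym degree≡) (miss unreached rest)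
      where
      degree≡ : cutDegree t⁺ (false ∷ F) a ≡ cutDegree t F a
      degree≡ rewrite dec-false (a ≟ v) a≢v | dec-false (a ≟ rep t F u) neq = refl

      unreached : ¬ Border t⁺ (false ∷ F) a v
      unreached (_ , y , ≡a , inj₁ (_ , refl))           = neq (trans (sym ≡a) (old u∈))
      unreached (_ , y , ≡a , inj₂ (inj₁ (refl , refl))) = v∉ u∈
      unreached (_ , y , ≡a , inj₂ (inj₂ near))          = v∉ (proj₁ (near∈ t V near))

-- Counting marks over the components

module Multiplicities {A : Set} (_≟_ : DecidableEquality A) where
  open Forests _≟_

  total : ∀ {m} → List A → Vec A m → ℕ
  total τ ms = sum (List.map (λ a → mult a ms) τ)

  total-[] : ∀ τ → total τ [] ≡ 0
  total-[] []      = refl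
  total-[] (_ ∷ τ) = total-[] τ

  total-∉ : ∀ {m x τ} (ms : Vec A m) → x ∉ τ → total τ (x ∷ ms) ≡ total τ ms
  total-∉ {τ = []}    ms x∉ = refl
  total-∉ {τ = a ∷ τ} ms x∉ = cong₂ ℕ._+_ (mult-≢ {ms = ms} λ { refl → x∉ (here refl) }) (total-∉ ms (x∉ ∘ there))

  total-∈ : ∀ {m x τ} (ms : Vec A m) → Unique τ → x ∈ τ → total τ (x ∷ ms) ≡ suc (total τ ms)
  total-∈ ms (x∉ ∷ u) (here refl) =
    cong₂ ℕ._+_ (mult-≡ {ms = ms} refl) (total-∉ ms λ x∈ → All.lookup x∉ x∈ refl)
  total-∈ {τ = a ∷ τ} ms (a∉ ∷ u) (there x∈) =
    trans (cong₂ ℕ._+_ (mult-≢ {ms = ms} (All.lookup a∉ x∈)) (total-∈ ms u x∈)) (ℕ.+-suc (mult a ms) (total τ ms))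

  total-length : ∀ {m τ} {ms : Vec A m} → Unique τ → AllVec (_∈ τ) ms → total τ ms ≡ m
  total-length {τ = τ} u []  = total-[] τ
  total-length {ms = x ∷ ms} u (x∈ ∷ ms∈) = trans (total-∈ ms u x∈) (cong suc (total-length u ms∈))

  covers-length : ∀ {m τ} (ms : Vec A m) → Covers τ ms → total τ ms ≡ length τ
  covers-length ms []       = refl
  covers-length ms (c ∷ cs) = cong₂ ℕ._+_ c (covers-length ms cs)

  length≤total : ∀ {m τ} (ms : Vec A m) → All (λ a → 1 ≤ mult a ms) τ → length τ ≤ total τ ms
  length≤total ms []       = z≤n
  length≤total ms (c ∷ cs) = ℕ.+-mono-≤ c (length≤total ms cs)

  -- Pigeonhole: multiplicities that are at least 1 and average 1 are all equal to 1.
  length-covers : ∀ {m τ} (ms : Vec A m) → All (λ a → 1 ≤ mult a ms) τ → total τ ms ≡ length τ → Covers τ ms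
  length-covers ms [] _ = []
  length-covers {τ = a ∷ τ} ms (c ∷ cs) eq = c≡1 ∷ length-covers ms cs rest
    where
    c≡1 : mult a ms ≡ 1
    c≡1 = ℕ.≤-antisym (ℕ.+-cancelʳ-≤ (length τ) _ _
      (ℕ.≤-trans (ℕ.+-monoʳ-≤ (mult a ms) (length≤total ms cs)) (ℕ.≤-reflexive eq))) c

    rest : total τ ms ≡ length τ
    rest = ℕ.suc-injective (trans (cong (ℕ._+ total τ ms) (sym c≡1)) eq)

member-count : ∀ {n m c} (C : Subset n) (xs : Vec (Fin n) m) →
  count (Subset._∈? (c ∷ C)) (Vec.map suc xs) ≡ count (Subset._∈? C) xs
member-count C []       = refl
member-count C (x ∷ xs) with does (x Subset.∈? C)
... | true  = cong suc (member-count C xs)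
... | false = member-count C xs

∣∩∣-count : ∀ {n} (C S : Subset n) → ∣ C ∩ S ∣ ≡ count (Subset._∈? C) (elements S)
∣∩∣-count []            []            = refl
∣∩∣-count (inside  ∷ C) (inside  ∷ S) = cong suc (trans (∣∩∣-count C S) (sym (member-count C (elements S))))
∣∩∣-count (outside ∷ C) (inside  ∷ S) = trans (∣∩∣-count C S) (sym (member-count C (elements S)))
∣∩∣-count (inside  ∷ C) (outside ∷ S) = trans (∣∩∣-count C S) (sym (member-count C (elements S)))
∣∩∣-count (outside ∷ C) (outside ∷ S) = trans (∣∩∣-count C S) (sym (member-count C (elements S)))

nonempty⇒∣∣≢0 : ∀ {n} {p : Subset n} → Nonempty p → ∣ p ∣ ≢ 0
nonempty⇒∣∣≢0 {p = inside  ∷ p} _                   ()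
nonempty⇒∣∣≢0 {p = outside ∷ p} (suc x , Vec.there x∈) = nonempty⇒∣∣≢0 {p = p} (x , x∈)

empty⇒∣∣≡0 : ∀ {n} {p : Subset n} → ¬ Nonempty p → ∣ p ∣ ≡ 0
empty⇒∣∣≡0 {n} ¬ne = trans (cong ∣_∣ (Subset.Empty-unique ¬ne)) (Subset.∣⊥∣≡0 n)

does⁻ : ∀ {P : Set} (P? : Dec P) → does P? ≡ true → P
does⁻ (yes p) _ = p

-- From the components of a spanning subgraph to representatives

module Components {n} {T : Graph n} (tree : IsTree T)
  (g : Distance.Growth tree) (spans : ∀ z → z ∈ verts (Distance.tree⁺ g)) where

  open Graph T
  open Distance tree
  open Forests (Fin._≟_ {n})
  open Boundaries (Fin._≟_ {n})
  open Multiplicities (Fin._≟_ {n})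

  t : Tree (Fin n) (size g)
  t = tree⁺ g

  es : Vec (Fin #E) (size g)
  es = labels g

  es-complete : ∀ e → e ∈ᵥ es
  es-complete e = edges-complete t es (valid g) (labelled g) (spans _) (spans _) (inj₁ refl)

  near⇒adj : ∀ {k} (t : Tree (Fin n) k) es {w y} → Labelled t es → Near t w y → Adj T ⊤ w y
  near⇒adj (sprout v u t) (e ∷ es) (l , _) (inj₁ (refl , refl))        = edge l
  near⇒adj (sprout v u t) (e ∷ es) (l , _) (inj₂ (inj₁ (refl , refl))) = edge (swap l)
  near⇒adj (sprout v u t) (e ∷ es) (_ , L) (inj₂ (inj₂ near))          = near⇒adj t es L near

  ends-unique : ∀ {e i j v u} → Ends e v u → Ends e i j → (i ≡ v × j ≡ u) ⊎ (i ≡ u × j ≡ v)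
  ends-unique (inj₁ p) (inj₁ q) with trans (sym p) q
  ... | refl = inj₁ (refl , refl)
  ends-unique (inj₁ p) (inj₂ q) with trans (sym p) q
  ... | refl = inj₂ (refl , refl)
  ends-unique (inj₂ p) (inj₁ q) with trans (sym p) q
  ... | refl = inj₂ (refl , refl)
  ends-unique (inj₂ p) (inj₂ q) with trans (sym p) q
  ... | refl = inj₁ (refl , refl)

  ends⇒near : ∀ {k} (t : Tree (Fin n) k) es {e w y} → Labelled t es → e ∈ᵥ es → Ends e w y → Near t w y
  ends⇒near (sprout v u t) (e ∷ es) (l , _) (AnyVec.here refl) l′ with ends-unique l l′
  ... | inj₁ eqs = inj₁ eqs
  ... | inj₂ eqs = inj₂ (inj₁ eqs)
  ends⇒near (sprout v u t) (e ∷ es) (_ , L) (AnyVec.there e∈) l′ = inj₂ (inj₂ (ends⇒near t es L e∈ l′))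

  kept⇒same-rep : ∀ {k} (t : Tree (Fin n) k) es F {e i j} → Valid t → Labelled t es → e ∈ᵥ es →
    lookup F e ≡ true → Ends e i j → rep t (restrict es F) i ≡ rep t (restrict es F) j
  kept⇒same-rep (sprout v u t) (e ∷ es) F {i = i} {j} (v∉ , u∈ , V) (l , L) (AnyVec.here refl) kept l′
    rewrite kept = oriented (ends-unique l l′)
    where
    b = true ∷ restrict es F

    joined : rep (sprout v u t) b v ≡ rep (sprout v u t) b u
    joined = trans (rep-joined t (restrict es F)) (sym (rep-old t true (restrict es F) λ { refl → v∉ u∈ }))

    oriented : (i ≡ v × j ≡ u) ⊎ (i ≡ u × j ≡ v) → rep (sprout v u t) b i ≡ rep (sprout v u t) b j
    oriented (inj₁ (refl , refl)) = joined
    oriented (inj₂ (refl , refl)) = sym joined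
  kept⇒same-rep (sprout v u t) (e′ ∷ es) F (v∉ , u∈ , V) (l , L) (AnyVec.there e∈) kept l′
    with ends∈ t es V L e∈ l′
  ... | i∈ , j∈ = trans (old i∈) (trans (kept⇒same-rep t es F V L e∈ kept l′) (sym (old j∈)))
    where
    old : ∀ {x} → x ∈ verts t → rep (sprout v u t) (restrict (e′ ∷ es) F) x ≡ rep t (restrict es F) x
    old x∈ = rep-old t (lookup F e′) (restrict es F) λ { refl → v∉ x∈ }

  -- Together with `kept⇒same-rep`, this shows that two vertices are joined in `F` exactly if their
  -- representatives agree. The components of `F` are thus the fibres of `rep`, one for each element
  -- of `tops`.
  rep-walk : ∀ {k} (t : Tree (Fin n) k) es F {x} → Valid t → Labelled t es → x ∈ verts t →
    Walk T F x (rep t (restrict es F) x)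
  rep-walk (seed r) [] F _ _ _ = ε
  rep-walk (sprout v u t) (e ∷ es) F {x} (v∉ , u∈ , V) (l , L) x∈ with x Fin.≟ v | lookup F e in kept | x∈
  ... | yes refl | true  | _        = (e , Vec.lookup⇒[]= e F kept , l) ◅ rep-walk t es F V L u∈
  ... | yes refl | false | _        = ε
  ... | no x≢v   | _     | here eq  = ⊥-elim (x≢v eq)
  ... | no _     | _     | there x∈ = rep-walk t es F V L x∈

  rep-top : ∀ {k} (t : Tree (Fin n) k) F {a} → Valid t → a ∈ tops t F → rep t F a ≡ a
  rep-top (seed r) [] _ (here refl) = refl
  rep-top (sprout v u t) (true ∷ F) (v∉ , _ , V) a∈ =
    trans (rep-old t true F λ { refl → v∉ (tops⊆verts t F a∈) }) (rep-top t F V a∈)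
  rep-top (sprout v u t) (false ∷ F) (v∉ , _ , V) (here refl) = rep-cut {u = u} t F
  rep-top (sprout v u t) (false ∷ F) (v∉ , _ , V) (there a∈) =
    trans (rep-old {u = u} t false F λ { refl → v∉ (tops⊆verts t F a∈) }) (rep-top t F V a∈)

  module _ (F : Spanning T) where

    private
      b : Vec Bool (size g)
      b = restrict es F

      ρ : Fin n → Fin n
      ρ = rep t b

      τ : List (Fin n)
      τ = tops t b

    τ-unique : Unique τ
    τ-unique = tops-unique t b (valid g)

    ρ∈τ : ∀ x → ρ x ∈ τ
    ρ∈τ x = rep∈tops t b (valid g) (spans x)

    ρ-top : ∀ {a} → a ∈ τ → ρ a ≡ a
    ρ-top = rep-top t b (valid g)

    walk⇒same-rep : ∀ {i j} → Walk T F i j → ρ i ≡ ρ j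
    walk⇒same-rep ε = refl
    walk⇒same-rep ((e , e∈F , l) ◅ w) =
      trans (kept⇒same-rep t es F (valid g) (labelled g) (es-complete e) (Vec.[]=⇒lookup e∈F) l) (walk⇒same-rep w)

    same-rep⇒walk : ∀ {i j} → ρ i ≡ ρ j → Walk T F i j
    same-rep⇒walk {i} {j} eq =
      subst (Walk T F i) eq (rep-walk t es F (valid g) (labelled g) (spans i)) ◅◅
      reversal T (rep-walk t es F (valid g) (labelled g) (spans j))

    component⁺ : ∀ {i j} → ρ i ≡ ρ j → j ∈ˢ component T F i
    component⁺ {i} {j} eq = Vec.lookup⇒[]= j _
      (trans (Vec.lookup∘tabulate _ j) (dec-true (connected? T F i j) (same-rep⇒walk eq)))

    component⁻ : ∀ {i j} → j ∈ˢ component T F i → ρ i ≡ ρ j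
    component⁻ {i} {j} j∈ = walk⇒same-rep (does⁻ (connected? T F i j)
      (trans (sym (Vec.lookup∘tabulate _ j)) (Vec.[]=⇒lookup j∈)))

    component-cong : ∀ {i j} → ρ i ≡ ρ j → component T F i ≡ component T F j
    component-cong {i} {j} eq = Vec.tabulate-cong λ x → does-⇔
      (mk⇔ (λ w → same-rep⇒walk (trans (sym eq) (walk⇒same-rep w)))
           (λ w → same-rep⇒walk (trans eq (walk⇒same-rep w))))
      (connected? T F i x) (connected? T F j x)

    component-injective : ∀ {a a′} → a ∈ τ → a′ ∈ τ → component T F a ≡ component T F a′ → a ≡ a′
    component-injective a∈ a′∈ eq = trans (sym (ρ-top a∈))
      (trans (component⁻ (subst (_ ∈ˢ_) (sym eq) (component⁺ refl))) (ρ-top a′∈))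

    component∈ : ∀ i → component T F i ∈ components T F
    component∈ i = ∈-deduplicate⁺ (Vec.≡-dec Bool._≟_) (∈-map⁺ (component T F) (∈-allFin i))

    components-top : ∀ {C} → C ∈ components T F → ∃[ a ] a ∈ τ × C ≡ component T F a
    components-top C∈ with ∈-map⁻ (component T F) (∈-deduplicate⁻ (Vec.≡-dec Bool._≟_) (List.map (component T F) (allFin n)) C∈)
    ... | i , _ , refl = ρ i , ρ∈τ i , component-cong (sym (ρ-top (ρ∈τ i)))

    components-unique : Unique (components T F)
    components-unique = DecUnique.deduplicate-! (Vec.≡-dec Bool._≟_) (List.map (component T F) (allFin n))

    map-component-unique : ∀ {σ} → Unique σ → (∀ {a} → a ∈ σ → a ∈ τ) → Unique (List.map (component T F) σ)
    map-component-unique []       _  = []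
    map-component-unique (a∉ ∷ u) σ⊆ = All.tabulate fresh ∷ map-component-unique u (σ⊆ ∘ there)
      where
      fresh : ∀ {C} → C ∈ List.map (component T F) _ → component T F _ ≢ C
      fresh C∈ eq with ∈-map⁻ (component T F) C∈
      ... | a′ , a′∈ , refl = All.lookup a∉ a′∈ (component-injective (σ⊆ (here refl)) (σ⊆ (there a′∈)) eq)

    length-components : length (components T F) ≡ length τ
    length-components = trans (↭-length (unique-↭ components-unique (map-component-unique τ-unique λ a∈ → a∈) to from))
                              (List.length-map (component T F) τ)
      where
      to : ∀ {C} → C ∈ components T F → C ∈ List.map (component T F) τ
      to C∈ with components-top C∈
      ... | a , a∈ , refl = ∈-map⁺ (component T F) a∈

      from : ∀ {C} → C ∈ List.map (component T F) τ → C ∈ components T F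
      from C∈ with ∈-map⁻ (component T F) C∈
      ... | a , _ , refl = component∈ a

    -- A top is its own representative, so a vertex of `S` lies in the component of `a` exactly when
    -- its representative is `a`.
    component-mult : ∀ {a} (S : Subset n) → a ∈ τ →
      ∣ component T F a ∩ S ∣ ≡ mult a (reps t b (elements S))
    component-mult {a} S a∈ = trans (∣∩∣-count (component T F a) S) (go (elements S))
      where
      go : ∀ {m} (xs : Vec (Fin n) m) → count (Subset._∈? component T F a) xs ≡ mult a (Vec.map ρ xs)
      go []       = refl
      go (x ∷ xs) rewrite does-⇔ (mk⇔ (λ x∈ → trans (sym (ρ-top a∈)) (component⁻ x∈))
                                       (λ eq → component⁺ (trans (ρ-top a∈) eq)))
                                 (x Subset.∈? component T F a) (a Fin.≟ ρ x) with does (a Fin.≟ ρ x)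
      ... | true  = cong suc (go xs)
      ... | false = go xs

    -- Listing the vertices in growth order instead of that of `allFin n` does not change the
    -- number, and brings it within reach of `counts-border`.
    boundaryDegree-component : ∀ {a} → a ∈ τ → boundaryDegree T (component T F a) ≡ cutDegree t b a
    boundaryDegree-component {a} a∈ = trans
      (↭-length (filter-↭ (boundary? T (component T F a))
        (unique-↭ (Unique.allFin⁺ n) (verts-unique t (valid g)) (λ _ → spans _) (λ _ → ∈-allFin _))))
      (counts-filter (boundary? T (component T F a))
        (counts-resp (λ _ → to) (λ _ → from) (counts-border t b (valid g) a∈)))
      where
      to : ∀ {w} → Border t b a w → Boundary T (component T F a) w
      to (≢a , y , ≡a , near) =
        (λ w∈ → ≢a (trans (sym (component⁻ w∈)) (ρ-top a∈))) ,
        y , component⁺ (trans (ρ-top a∈) (sym ≡a)) , near⇒adj t es (labelled g) near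

      from : ∀ {w} → Boundary T (component T F a) w → Border t b a w
      from (w∉ , y , y∈ , e , _ , l) =
        (λ eq → w∉ (component⁺ (trans (ρ-top a∈) (sym eq)))) ,
        y , trans (sym (component⁻ y∈)) (ρ-top a∈) , ends⇒near t es (labelled g) (es-complete e) l

    module _ (S : Subset n) where

      private
        ms : Vec (Fin n) ∣ S ∣
        ms = reps t b (elements S)

      reps⊆tops : ∀ {m} (xs : Vec (Fin n) m) → AllVec (_∈ τ) (reps t b xs)
      reps⊆tops []       = []
      reps⊆tops (x ∷ xs) = ρ∈τ x ∷ reps⊆tops xs

      total-reps : total τ ms ≡ ∣ S ∣
      total-reps = total-length τ-unique (reps⊆tops (elements S))

      total-reps⁺ : ∀ {a} → a ∈ τ → total τ (a ∷ ms) ≡ suc ∣ S ∣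
      total-reps⁺ a∈ = trans (total-∈ ms τ-unique a∈) (cong suc total-reps)

      Rooted⇒Covers : Rooted T S F → Covers τ ms
      Rooted⇒Covers (_ , one) = All.tabulate λ {a} a∈ →
        trans (sym (component-mult S a∈)) (All.lookup one (component∈ a))

      -- The number of components comes from counting the marks twice: one for each top, and one for
      -- each vertex of `S`.
      Covers⇒Rooted : Covers τ ms → Rooted T S F
      Covers⇒Rooted c = trans length-components (trans (sym (covers-length ms c)) total-reps) , All.tabulate one
        where
        one : ∀ {C} → C ∈ components T F → ∣ C ∩ S ∣ ≡ 1
        one C∈ with components-top C∈
        ... | a , a∈ , refl = trans (component-mult S a∈) (All.lookup c a∈)

      rooted≡cov : 𝟙 (rooted? T S F) ≡ cov τ ms
      rooted≡cov = trans (𝟙-⇔ (rooted? T S F) (covers? τ ms) Rooted⇒Covers Covers⇒Rooted) (sym (cov≡𝟙 τ ms))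

      private
        floating? : ∀ C → Dec (¬ Nonempty (C ∩ S))
        floating? C = ¬? (Subset.nonempty? (C ∩ S))

        floats⁺ : ∀ {a} → a ∈ τ → mult a ms ≡ 0 → component T F a ∈ floatingComponents T S F
        floats⁺ {a} a∈ eq = ∈-filter⁺ floating? (component∈ a)
          λ ne → nonempty⇒∣∣≢0 {p = component T F a ∩ S} ne (trans (component-mult S a∈) eq)

        floats⁻ : ∀ {C} → C ∈ floatingComponents T S F → ∃[ a ] a ∈ τ × C ≡ component T F a × mult a ms ≡ 0
        floats⁻ C∈ with ∈-filter⁻ floating? {xs = components T F} C∈
        ... | C∈′ , ¬ne with components-top C∈′
        ...   | a , a∈ , refl = a , a∈ , refl , trans (sym (component-mult S a∈)) (empty⇒∣∣≡0 ¬ne)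

        uncovered : ∀ {a a′} → a ∈ τ → Covers τ (a′ ∷ ms) → mult a ms ≡ 0 → a ≡ a′
        uncovered {a} {a′} a∈ c eq with a Fin.≟ a′
        ... | yes a≡a′ = a≡a′
        ... | no a≢a′  = ⊥-elim (ℕ.0≢1+n (trans (sym eq)
          (trans (sym (mult-≢ {ms = ms} a≢a′)) (All.lookup c a∈))))

        covers-self : ∀ {a} → a ∈ τ → Covers τ (a ∷ ms) → mult a ms ≡ 0
        covers-self a∈ c = ℕ.suc-injective (trans (sym (mult-≡ {ms = ms} refl)) (All.lookup c a∈))

      singleton : ∀ {X : Set} {x : X} {xs} → Unique xs → x ∈ xs → (∀ {y} → y ∈ xs → y ≡ x) → xs ≡ [ x ]
      singleton {xs = _ ∷ []} _ (here refl) _ = refl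
      singleton {xs = y ∷ z ∷ _} (y∉ ∷ _) _ all≡x =
        ⊥-elim (All.lookup y∉ (here refl) (trans (all≡x (here refl)) (sym (all≡x (there (here refl))))))

      floatingComponents-covers : ∀ {a} → a ∈ τ → Covers τ (a ∷ ms) → floatingComponents T S F ≡ [ component T F a ]
      floatingComponents-covers {a} a∈ c = singleton (Unique.filter⁺ floating? components-unique)
        (floats⁺ a∈ (covers-self a∈ c)) λ C∈ → same (floats⁻ C∈)
        where
        same : ∀ {C} → ∃[ a′ ] a′ ∈ τ × C ≡ component T F a′ × mult a′ ms ≡ 0 → C ≡ component T F a
        same (a′ , a′∈ , refl , eq) = cong (component T F) (uncovered a′∈ c eq)

      Covers⇒*-Rooted : ∀ {a} → a ∈ τ → Covers τ (a ∷ ms) → *-Rooted T S F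
      Covers⇒*-Rooted {a} a∈ c =
        trans length-components (trans (sym (covers-length (a ∷ ms) c)) (total-reps⁺ a∈)) ,
        cong length (floatingComponents-covers a∈ c)

      -- Every component but the floating one meets `S`, and the floating one is hit by the extra
      -- entry `a`. These are `suc ∣ S ∣` marks on as many components, so by `length-covers` each
      -- component has exactly one.
      *-Rooted⇒Covers : *-Rooted T S F → ∃[ a ] a ∈ τ × Covers τ (a ∷ ms)
      *-Rooted⇒Covers (len , one) = from (floatingComponents T S F) refl one
        where
        from : ∀ Cs → floatingComponents T S F ≡ Cs → length Cs ≡ 1 → ∃[ a ] a ∈ τ × Covers τ (a ∷ ms)
        from (C ∷ []) eq _ with floats⁻ (subst (C ∈_) (sym eq) (here refl))
        ... | a , a∈ , refl , _ = a , a∈ , length-covers (a ∷ ms) (All.tabulate positive)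
          (trans (total-reps⁺ a∈) (trans (sym len) length-components))
          where
          positive : ∀ {a′} → a′ ∈ τ → 1 ≤ mult a′ (a ∷ ms)
          positive {a′} a′∈ with a′ Fin.≟ a
          ... | yes _ = s≤s z≤n
          ... | no a′≢a = ℕ.n≢0⇒n>0 λ none → a′≢a (component-injective a′∈ a∈
            (only (subst (component T F a′ ∈_) eq (floats⁺ a′∈ none))))
            where
            only : ∀ {C} → C ∈ [ component T F a ] → C ≡ component T F a
            only (here refl) = refl

      floating-component : ∀ {a} → a ∈ τ → Covers τ (a ∷ ms) → floating T S F ≡ component T F a
      floating-component {a} a∈ c rewrite floatingComponents-covers a∈ c = Subset.∪-identityʳ (component T F a)

      -- At most one top can be the one that the marks miss, so the sum over tops has a single
      -- nonzero indicator if `F` is in `𝓕₂`, and none otherwise.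
      floating-term : (*-rooted : Dec (*-Rooted T S F)) →
        𝟙 *-rooted * φ (+ boundaryDegree T (floating T S F)) ≡
          sumOver τ (λ a → cov τ (a ∷ ms) * φ (+ cutDegree t b a))
      floating-term (no ¬r) = sym (sumOver-0 τ λ {a} a∈ → cong (_* φ (+ cutDegree t b a))
        (trans (cov≡𝟙 τ (a ∷ ms)) (𝟙-no (covers? τ (a ∷ ms)) (¬r ∘ Covers⇒*-Rooted a∈))))
      floating-term (yes r) with *-Rooted⇒Covers r
      ... | a₀ , a₀∈ , c = begin
        1ℤ * φ (+ boundaryDegree T (floating T S F))
          ≡⟨ ℤ.*-identityˡ _ ⟩
        φ (+ boundaryDegree T (floating T S F))
          ≡⟨ cong (λ l → φ (+ l)) (trans (cong (boundaryDegree T) (floating-component a₀∈ c))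
                                         (boundaryDegree-component a₀∈)) ⟩
        φ (+ cutDegree t b a₀)
          ≡⟨ sumOver-select Fin._≟_ τ-unique a₀∈ (λ a → φ (+ cutDegree t b a)) ⟨
        sumOver τ (λ a → 𝟙 (a Fin.≟ a₀) * φ (+ cutDegree t b a))
          ≡⟨ sumOver-cong τ (λ {a} a∈ → cong (_* φ (+ cutDegree t b a))
               (trans (𝟙-⇔ (a Fin.≟ a₀) (covers? τ (a ∷ ms)) (λ { refl → c })
                            (λ c′ → uncovered a∈ c (covers-self a∈ c′)))
                      (sym (cov≡𝟙 τ (a ∷ ms))))) ⟩
        sumOver τ (λ a → cov τ (a ∷ ms) * φ (+ cutDegree t b a)) ∎

  es-unique : ∀ {k} (t : Tree (Fin n) k) es → Valid t → Labelled t es → UniqueVec es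
  es-unique (seed r)       []       _ _ = AllPairsVec.[]
  es-unique (sprout v u t) (e ∷ es) valid labelled =
    distinct es (edge∉ v u t e es valid labelled) AllPairsVec.∷ es-unique t es (proj₂ (proj₂ valid)) (proj₂ labelled)
    where
    distinct : ∀ {k} (es : Vec (Fin #E) k) {e} → ¬ e ∈ᵥ es → AllVec (e ≢_) es
    distinct []       e∉ = []
    distinct (_ ∷ es) e∉ = (e∉ ∘ AnyVec.here) ∷ distinct es (e∉ ∘ AnyVec.there)

  module _ (S : Subset n) where

    private
      ∑-forests : (f : Vec Bool (size g) → ℤ) → sumOver (subsets #E) (f ∘ restrict es) ≡ ∑ f
      ∑-forests = ∑-restrict es (es-unique t es (valid g) (labelled g)) es-complete

    length-𝓕₁ : + length (𝓕₁ T S) ≡ rooted t (elements S)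
    length-𝓕₁ = trans (length-filter (rooted? T S) (subsets #E))
      (trans (sumOver-cong (subsets #E) λ {F} _ → rooted≡cov F S)
             (∑-forests λ b → cov (tops t b) (reps t b (elements S))))

    sumOver-𝓕₂ : sumOver (𝓕₂ T S) (λ F → φ (+ boundaryDegree T (floating T S F))) ≡ floatingΣ t (elements S)
    sumOver-𝓕₂ = trans (sumOver-filter (*-rooted? T S) _ (subsets #E))
      (trans (sumOver-cong (subsets #E) λ {F} _ → floating-term F S (*-rooted? T S F))
             (∑-forests λ b → sumOver (tops t b) λ a →
               cov (tops t b) (a ∷ reps t b (elements S)) * φ (+ cutDegree t b a)))

-- The determinant formula

[-2]^k≡[-1]^k*2^k : ∀ k → (- + 2) ^ k ≡ -1ℤ ^ k * (+ 2) ^ k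
[-2]^k≡[-1]^k*2^k zero    = refl
[-2]^k≡[-1]^k*2^k (suc k) = trans (cong (- + 2 *_) ([-2]^k≡[-1]^k*2^k k)) (regroup (-1ℤ ^ k) ((+ 2) ^ k))
  where
  regroup : ∀ a b → - + 2 * (a * b) ≡ -1ℤ * a * (+ 2 * b)
  regroup = solve-∀

-- For `2 ≤ m` the factor -(-2)^m equals 4 (-1)^(m-1) 2^(m-2), and the 4 cancels in `ℤ`.
cancel-4 : ∀ {m} → 2 ≤ m → ∀ x N Φ → + 4 * x ≡ - ((- + 2) ^ m * ((+ m - + 1) * N - Φ)) →
  x ≡ -1ℤ ^ (m ∸ 1) * (+ 2) ^ (m ∸ 2) * (+ (m ∸ 1) * N - Φ)
cancel-4 {suc (suc k)} (s≤s (s≤s _)) x N Φ eq = ℤ.*-cancelˡ-≡ (+ 4) x _ (begin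
  + 4 * x
    ≡⟨ eq ⟩
  - (- + 2 * (- + 2 * (- + 2) ^ k) * ((1ℤ + + suc k - + 1) * N - Φ))
    ≡⟨ cong (λ q → - (- + 2 * (- + 2 * q) * ((1ℤ + + suc k - + 1) * N - Φ))) ([-2]^k≡[-1]^k*2^k k) ⟩
  - (- + 2 * (- + 2 * (-1ℤ ^ k * (+ 2) ^ k)) * ((1ℤ + + suc k - + 1) * N - Φ))
    ≡⟨ regroup (-1ℤ ^ k) ((+ 2) ^ k) (+ suc k) N Φ ⟩
  + 4 * (-1ℤ ^ suc k * (+ 2) ^ k * (+ suc k * N - Φ)) ∎)
  where
  regroup : ∀ a b e N Φ → - (- + 2 * (- + 2 * (a * b)) * ((1ℤ + e - + 1) * N - Φ)) ≡
                          + 4 * (-1ℤ * a * b * (e * N - Φ))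
  regroup = solve-∀

module _ {n} {T : Graph n} (tree : IsTree T) (S : Subset n)
  (g : Distance.Growth tree) (spans : ∀ z → z ∈ verts (Distance.tree⁺ g)) where

  open Distance tree
  open Forests (Fin._≟_ {n})
  open Components tree g spans
  open Minors (Fin._≟_ {n}) D D-self D-sym
  open Bracket D∞ D∞-sym
  open Invariants (Fin._≟_ {n}) D D-self D-sym

  plain≡det : plain (elements S) ≡ det (principal D S)
  plain≡det = trans (bracket≡det (elements S ⁺) (elements S ⁺)) (det-cong entry)
    where
    entry : ∀ i j → D∞ (lookup (elements S ⁺) i) (lookup (elements S ⁺) j) ≡ principal D S i j
    entry i j = cong₂ D∞ (Vec.lookup-map i just (elements S)) (Vec.lookup-map j just (elements S))

  det-forests : + 4 * plain (elements S) ≡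
    - ((- + 2) ^ ∣ S ∣ * ((+ ∣ S ∣ - + 1) * rooted t (elements S) - floatingΣ t (elements S)))
  det-forests = Invariants.plain-minor (invariants t (valid g) (metric t es (valid g) (labelled g)))
    (AllVec.universal spans (elements S))

  forest-formula : 2 ≤ ∣ S ∣ → det (principal D S) ≡
    -1ℤ ^ (∣ S ∣ ∸ 1) * (+ 2) ^ (∣ S ∣ ∸ 2)
      * (+ (∣ S ∣ ∸ 1) * + length (𝓕₁ T S) - sumOver (𝓕₂ T S) (λ F → φ (+ boundaryDegree T (floating T S F))))
  forest-formula 2≤∣S∣ = begin
    det (principal D S)
      ≡⟨ plain≡det ⟨
    plain (elements S)
      ≡⟨ cancel-4 2≤∣S∣ (plain (elements S)) (rooted t (elements S)) (floatingΣ t (elements S)) det-forests ⟩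
    signed (rooted t (elements S)) (floatingΣ t (elements S))
      ≡⟨ cong₂ signed (length-𝓕₁ S) (sumOver-𝓕₂ S) ⟨
    signed (+ length (𝓕₁ T S)) (sumOver (𝓕₂ T S) λ F → φ (+ boundaryDegree T (floating T S F))) ∎
    where
    signed : ℤ → ℤ → ℤ
    signed N Φ = -1ℤ ^ (∣ S ∣ ∸ 1) * (+ 2) ^ (∣ S ∣ ∸ 2) * (+ (∣ S ∣ ∸ 1) * N - Φ)

theoremA : ∀ {n : ℕ} (T : Graph n) (tree : IsTree T) (S : Subset n) → 2 ≤ ∣ S ∣ →
    det (principal (distanceMatrix tree) S)
      ≡ -1ℤ ^ (∣ S ∣ ∸ 1) * (+ 2) ^ (∣ S ∣ ∸ 2)
        * (+ (∣ S ∣ ∸ 1) * + length (𝓕₁ T S)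
           - sumOver (𝓕₂ T S) (λ F → let δ = + boundaryDegree T (floating T S F) in (δ - + 1) * (δ - + 4)))
-- The growth starts from a vertex, so the empty graph is set apart; there `2 ≤ ∣ S ∣` is absurd.
theoremA {zero}  T tree [] ()
theoremA {suc n} T tree S  2≤∣S∣ =
  let g , spans = Distance.spanning-growth tree zero in forest-formula tree S g spans 2≤∣S∣
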